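{- For any multiplier (i.e. any shape $\mathbb U$), the following $\Psi$-type is implementable from the transpension type $\langle\mathsf t_u\mid-\rangle$ and the strictness axiom (both described in the context); that is, type and term formers satisfying the following rules can be defined. Formation: if $X,u:\mathbb U\mid\Gamma,\_:u\in\partial\mathbb U\vdash A$ type and $X\mid\Gamma,\hat x:((\_:u\in\partial\mathbb U)\to A),L_{\mathsf t}\vdash R$ type, then $X,u:\mathbb U\mid\Gamma\vdash\Psi_u(\hat x.A,R)$ type, such that $X,u:\mathbb U\mid\Gamma,\_:u\in\partial\mathbb U\vdash\Psi_u(\hat x.A,R)=A$. Introduction: if $X,u:\mathbb U\mid\Gamma,\_:u\in\partial\mathbb U\vdash a:A$ and $X\mid\Gamma,L_{\mathsf t}\vdash r:R[(\lambda\_.a)/\hat x,L_{\mathsf t}]$, then $X,u:\mathbb U\mid\Gamma\vdash\mathsf{in}\Psi_u(a,r):\Psi_u(\hat x.A,R)$, such that $X,u:\mathbb U\mid\Gamma,\_:u\in\partial\mathbb U\vdash\mathsf{in}\Psi_u(a,r)=a$. Elimination: if $\Gamma=(\Delta,L_\forall)$ with $X\mid\Delta$ ctx and $X,u:\mathbb U\mid\Delta,L_\forall\vdash q:\Psi_u(\hat x.A,R)$, then $X\mid\Delta\vdash\mathsf{out}\Psi_u(q):R[(\lambda\_.q)/\hat x,L_{\mathsf t}][\mathsf{const}_\Delta]$. $\beta$: $\mathsf{out}\Psi_u(\mathsf{in}\Psi_u(a,r))=r[\mathsf{const}_\Delta]$ (in the situation of the elimination rule). $\eta$: for every $X,u:\mathbb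 U\mid\Gamma\vdash q:\Psi_u(\hat x.A,R)$, $\ q=\mathsf{in}\Psi_u\big(q,\ \mathsf{out}\Psi_u(q[\mathsf{app}_\Gamma])\big)$.
   Context: Semantics. $\mathcal W$ is a category with terminal object $\top$. A multiplier for $U\in\mathcal W$ is an endofunctor $-\ltimes U:\mathcal W\to\mathcal W$ with $\top\ltimes U\cong U$; each shape $\mathbb U$ has an associated multiplier. $-\ltimes\mathbf yU$ on $\mathrm{Psh}(\mathcal W)$ is the left Kan extension of $-\ltimes U$ ($\mathbf y$ = Yoneda). For $\Xi\in\mathrm{Psh}(\mathcal W)$ with category of elements $\mathcal W/\Xi$, let $\mathsf F_U^{/\Xi}:\mathcal W/\Xi\to\mathcal W/(\Xi\ltimes\mathbf yU)$, $(W,\xi)\mapsto(W\ltimes U,\xi\ltimes\mathbf yU)$. The boundary $\Xi\ltimes\partial U\subseteq\Xi\ltimes\mathbf yU$ consists of the cells $\varphi$ (of shape $V$) for which there is no $\chi:W\ltimes U\to V$ with $\varphi\chi$ of the form $\xi\ltimes\mathbf yU$. Type system. Extensional multimode type theory MTT (Gratzer, Kavvos, Nuyts, Birkedal), with the usual type formers ($\Sigma$, $\Pi$, universes $\mathcal U_\ell$, extensional identity types) at each mode. Modes are the shape contexts $X$ (lists of shape variables, $[\![\cdot]\!]=\top$, $[\![X,u:\mathbb U]\!]=[\![X]\!]\ltimes\mathbf yU$); mode $X$ is interpreted in the standard presheaf model $\mathrm{Psh}(\mathcal W/[\![X]\!])$. Judgements at mode $X$ are written $X\mid\Gamma\vdash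 J$. A modality $\mu:X_1\to X_2$ is a functor (its lock functor) $\mathrm{Psh}(\mathcal W/[\![X_2]\!])\to\mathrm{Psh}(\mathcal W/[\![X_1]\!])$ that has a right adjoint; it acts on contexts and substitutions as $\Gamma\mapsto(\Gamma,L_\mu)$, $\sigma\mapsto(\sigma,L_\mu)$. The modal type $\langle\mu\mid A\rangle$ in $\Gamma$, for $A$ a type in $(\Gamma,L_\mu)$, has constructor $\mathrm{mod}_\mu$ taking terms $a:A$ in $(\Gamma,L_\mu)$ to terms of $\langle\mu\mid A\rangle$ in $\Gamma$. Each mode has a universe $\mathrm{Prop}$ of proof-irrelevant propositions (the subobject classifier), and at mode $(X,u:\mathbb U)$ there is a proposition $u\in\partial\mathbb U$ interpreted by $[\![X]\!]\ltimes\partial U\subseteq[\![X]\!]\ltimes\mathbf yU$. With $\Xi=[\![X]\!]$: $\forall_u:(X,u:\mathbb U)\to X$ is the modality with lock $L_\forall$ interpreted as left Kan extension along $\mathsf F_U^{/\Xi}$ and right adjoint precomposition with $\mathsf F_U^{/\Xi}$; $\mathsf t_u:X\to(X,u:\mathbb U)$ (transpension) is the modality with lock $L_{\mathsf t}$ interpreted as precomposition with $\mathsf F_U^{/\Xi}$ and right adjoint right Kan extension along $\mathsf F_U^{/\Xi}$; $\forall_u\dashv\mathsf t_u$ in the mode theory. The unit and co-unit of the adjunction $L_\forall\dashv L_{\mathsf t}$ give natural substitutions $\mathsf{const}_\Delta:\Delta\to(\Delta,L_\forall,L_{\mathsf t})$ (for $\Delta$ at mode $X$) and $\mathsf{app}_\Gamma:(\Gamma,L_{\mathsf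 t},L_\forall)\to\Gamma$ (for $\Gamma$ at mode $(X,u:\mathbb U)$). Transpension type $\langle\mathsf t_u\mid A\rangle$: besides formation and introduction as a modal type, for $X,u:\mathbb U\mid\Delta,L_\forall\vdash t:\langle\mathsf t_u\mid A\rangle$ there is $X\mid\Delta\vdash\mathsf{unmerid}_u(t):A[\mathsf{const}_\Delta]$, with $\beta$-law $\mathsf{unmerid}_u(\mathrm{mod}_{\mathsf t_u}(a))=a[\mathsf{const}_\Delta]$ and $\eta$-law $t=\mathrm{mod}_{\mathsf t_u}(\mathsf{unmerid}_u(t[\mathsf{app}_\Gamma]))$ for $X,u:\mathbb U\mid\Gamma\vdash t:\langle\mathsf t_u\mid A\rangle$. On the boundary it has a unique element: $X,u:\mathbb U\mid\Gamma,\_:u\in\partial\mathbb U\vdash\mathsf{pole}:\langle\mathsf t_u\mid A\rangle$, and $t=\mathsf{pole}$ for all $t$ of that type there. Strictness axiom (at any mode): given $\Gamma\vdash\varphi:\mathrm{Prop}$, $\Gamma\vdash A:\mathcal U_\ell$, $\Gamma,\_:\varphi\vdash T:\mathcal U_\ell$ and $\Gamma,\_:\varphi\vdash i:A\cong T$, there are $\Gamma\vdash S:\mathcal U_\ell$ and $\Gamma\vdash s:A\cong S$ such that $\Gamma,\_:\varphi\vdash S=T$ and $\Gamma,\_:\varphi\vdash s=i:A\cong T$. In the $\Psi$-rules, weakenings are implicit, and $\Psi_u(\hat x.A,R)$ binds $\hat x$ in $R$. In the elimination type, $\lambda\_.q$ denotes the element of $(\_:u\in\partial\mathbb U)\to A$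 obtained from $q$ via the equality $\Psi_u(\hat x.A,R)=A$ on the boundary. -}

module Defs where

open import Axiom.UniquenessOfIdentityProofs.WithK using (uip)
open import Level using (Level) renaming (suc to lsuc)
open import Data.Nat using (ℕ; zero; suc; _≤_; _⊔_)
open import Data.List using (List; []; _∷_)
open import Data.Product using (Σ; Σ-syntax; _,_)
open import Relation.Binary.PropositionalEquality
  using (_≡_; refl; sym; trans; cong)

-- Type theories are presented algebraically, by sorts, operations and
-- equations; judgemental equality is _≡_.  Substitution laws are listed for
-- all type and term formers except those (eliminators, reflexivity, ...) for
-- which they follow from the computation and uniqueness rules.

-- Extensional type theory with Σ, Π, identity types, universes and a subobject
-- classifier: the structure available at a single mode.
record ETT (a : Level) : Set (lsuc a) where
  infixl 9 _∘_
  infixl 8 _[_]ᵀ _[_]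
  infixl 5 _▹_
  infix  4 _∶_ _∈U_
  infixr 6 _⇒_ _×ᵀ_
  field
    Ctx : Set a
    Sub : Ctx → Ctx → Set a
    id  : ∀ {Γ} → Sub Γ Γ
    _∘_ : ∀ {Γ Δ Θ} → Sub Δ Θ → Sub Γ Δ → Sub Γ Θ
    idˡ : ∀ {Γ Δ} {σ : Sub Γ Δ} → id ∘ σ ≡ σ
    idʳ : ∀ {Γ Δ} {σ : Sub Γ Δ} → σ ∘ id ≡ σ
    assoc : ∀ {Γ Δ Θ Λ} {σ : Sub Θ Λ} {τ : Sub Δ Θ} {ρ : Sub Γ Δ} →
            (σ ∘ τ) ∘ ρ ≡ σ ∘ (τ ∘ ρ)
    ∙   : Ctx
    ε   : ∀ {Γ} → Sub Γ ∙
    ε-η : ∀ {Γ} {σ : Sub Γ ∙} → σ ≡ ε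

    Ty    : Ctx → Set a
    _[_]ᵀ : ∀ {Γ Δ} → Ty Δ → Sub Γ Δ → Ty Γ
    [id]ᵀ : ∀ {Γ} {A : Ty Γ} → A [ id ]ᵀ ≡ A
    [∘]ᵀ  : ∀ {Γ Δ Θ} {A : Ty Θ} {σ : Sub Δ Θ} {τ : Sub Γ Δ} →
            A [ σ ∘ τ ]ᵀ ≡ A [ σ ]ᵀ [ τ ]ᵀ

    -- As in a natural model, terms are not indexed by their types; instead
    -- every term has a type.  This makes type conversion silent.
    Tm    : Ctx → Set a
    _[_]  : ∀ {Γ Δ} → Tm Δ → Sub Γ Δ → Tm Γ
    [id]  : ∀ {Γ} {b : Tm Γ} → b [ id ] ≡ b
    [∘]   : ∀ {Γ Δ Θ} {b : Tm Θ} {σ : Sub Δ Θ} {τ : Sub Γ Δ} →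
            b [ σ ∘ τ ] ≡ b [ σ ] [ τ ]
    ty    : ∀ {Γ} → Tm Γ → Ty Γ
    ty-[] : ∀ {Γ Δ} {b : Tm Δ} {σ : Sub Γ Δ} → ty (b [ σ ]) ≡ ty b [ σ ]ᵀ

  _∶_ : ∀ {Γ} → Tm Γ → Ty Γ → Set a
  b ∶ A = ty b ≡ A

  field
    _▹_    : (Γ : Ctx) → Ty Γ → Ctx
    wk     : ∀ {Γ} {A : Ty Γ} → Sub (Γ ▹ A) Γ
    vz     : ∀ {Γ} {A : Ty Γ} → Tm (Γ ▹ A)
    vz∶    : ∀ {Γ} {A : Ty Γ} → vz {Γ} {A} ∶ A [ wk ]ᵀ
    ext    : ∀ {Γ Δ} {A : Ty Δ} (σ : Sub Γ Δ) (b : Tm Γ) → b ∶ A [ σ ]ᵀ →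
             Sub Γ (Δ ▹ A)
    wk-ext : ∀ {Γ Δ} {A : Ty Δ} {σ : Sub Γ Δ} {b : Tm Γ} {e : b ∶ A [ σ ]ᵀ} →
             wk ∘ ext {A = A} σ b e ≡ σ
    vz-ext : ∀ {Γ Δ} {A : Ty Δ} {σ : Sub Γ Δ} {b : Tm Γ} {e : b ∶ A [ σ ]ᵀ} →
             vz [ ext {A = A} σ b e ] ≡ b
    ext-η  : ∀ {Γ Δ} {A : Ty Δ} {τ : Sub Γ (Δ ▹ A)}
             (e : vz [ τ ] ∶ A [ wk ∘ τ ]ᵀ) → ext (wk ∘ τ) (vz [ τ ]) e ≡ τ

  ∶-[] : ∀ {Γ Δ} {b : Tm Δ} {A : Ty Δ} → b ∶ A → (σ : Sub Γ Δ) →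
         b [ σ ] ∶ A [ σ ]ᵀ
  ∶-[] e σ = trans ty-[] (cong _[ σ ]ᵀ e)

  inst : ∀ {Γ} {A : Ty Γ} (b : Tm Γ) → b ∶ A → Sub Γ (Γ ▹ A)
  inst b e = ext id b (trans e (sym [id]ᵀ))

  -- Lifting under a binder; the domain type need only equal A [ σ ]ᵀ
  -- propositionally.
  lift[_] : ∀ {Γ Δ} {A : Ty Δ} {A′ : Ty Γ} {σ : Sub Γ Δ} → A′ ≡ A [ σ ]ᵀ →
            Sub (Γ ▹ A′) (Δ ▹ A)
  lift[_] {σ = σ} e =
    ext (σ ∘ wk) vz (trans vz∶ (trans (cong _[ wk ]ᵀ e) (sym [∘]ᵀ)))

  _↑ : ∀ {Γ Δ} {A : Ty Δ} (σ : Sub Γ Δ) → Sub (Γ ▹ A [ σ ]ᵀ) (Δ ▹ A)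
  σ ↑ = lift[_] {σ = σ} refl

  field
    Π     : ∀ {Γ} (A : Ty Γ) → Ty (Γ ▹ A) → Ty Γ
    Π-[]  : ∀ {Γ Δ} {A : Ty Δ} {B : Ty (Δ ▹ A)} {σ : Sub Γ Δ} →
            Π A B [ σ ]ᵀ ≡ Π (A [ σ ]ᵀ) (B [ σ ↑ ]ᵀ)
    lam    : ∀ {Γ} {A : Ty Γ} → Tm (Γ ▹ A) → Tm Γ
    lam∶   : ∀ {Γ} {A : Ty Γ} {B : Ty (Γ ▹ A)} {b : Tm (Γ ▹ A)} → b ∶ B →
             lam b ∶ Π A B
    lam-[] : ∀ {Γ Δ} {A : Ty Δ} {b : Tm (Δ ▹ A)} {σ : Sub Γ Δ} →
             lam b [ σ ] ≡ lam (b [ σ ↑ ])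
    -- The generic application Γ, x : A ⊢ f x; the application to a particular
    -- argument is obtained by substitution.
    app   : ∀ {Γ} {A : Ty Γ} {B : Ty (Γ ▹ A)} (f : Tm Γ) → f ∶ Π A B →
            Tm (Γ ▹ A)
    app∶  : ∀ {Γ} {A : Ty Γ} {B : Ty (Γ ▹ A)} {f : Tm Γ} {e : f ∶ Π A B} →
            app f e ∶ B
    Π-β   : ∀ {Γ} {A : Ty Γ} {B : Ty (Γ ▹ A)} {b : Tm (Γ ▹ A)} (e : b ∶ B) →
            app (lam b) (lam∶ e) ≡ b
    Π-η   : ∀ {Γ} {A : Ty Γ} {B : Ty (Γ ▹ A)} {f : Tm Γ} {e : f ∶ Π A B} →
            lam (app f e) ≡ f

    Sg      : ∀ {Γ} (A : Ty Γ) → Ty (Γ ▹ A) → Ty Γ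
    Sg-[]   : ∀ {Γ Δ} {A : Ty Δ} {B : Ty (Δ ▹ A)} {σ : Sub Γ Δ} →
              Sg A B [ σ ]ᵀ ≡ Sg (A [ σ ]ᵀ) (B [ σ ↑ ]ᵀ)
    pair    : ∀ {Γ} {A : Ty Γ} {B : Ty (Γ ▹ A)} (b : Tm Γ) (e : b ∶ A)
              (c : Tm Γ) → c ∶ B [ inst b e ]ᵀ → Tm Γ
    pair∶   : ∀ {Γ} {A : Ty Γ} {B : Ty (Γ ▹ A)} {b : Tm Γ} {e : b ∶ A}
              {c : Tm Γ} {h : c ∶ B [ inst b e ]ᵀ} →
              pair {B = B} b e c h ∶ Sg A B
    pair-[] : ∀ {Γ Δ} {A : Ty Δ} {B : Ty (Δ ▹ A)} {b : Tm Δ} {e : b ∶ A}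
              {c : Tm Δ} {h : c ∶ B [ inst b e ]ᵀ} {σ : Sub Γ Δ}
              (e′ : b [ σ ] ∶ A [ σ ]ᵀ)
              (h′ : c [ σ ] ∶ B [ σ ↑ ]ᵀ [ inst (b [ σ ]) e′ ]ᵀ) →
              pair {B = B} b e c h [ σ ] ≡
              pair {B = B [ σ ↑ ]ᵀ} (b [ σ ]) e′ (c [ σ ]) h′
    fst     : ∀ {Γ} {A : Ty Γ} {B : Ty (Γ ▹ A)} (t : Tm Γ) → t ∶ Sg A B → Tm Γ
    fst∶    : ∀ {Γ} {A : Ty Γ} {B : Ty (Γ ▹ A)} {t : Tm Γ} {e : t ∶ Sg A B} →
              fst t e ∶ A
    snd     : ∀ {Γ} {A : Ty Γ} {B : Ty (Γ ▹ A)} (t : Tm Γ) → t ∶ Sg A B → Tm Γ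
    snd∶    : ∀ {Γ} {A : Ty Γ} {B : Ty (Γ ▹ A)} {t : Tm Γ} {e : t ∶ Sg A B} →
              snd t e ∶ B [ inst (fst t e) fst∶ ]ᵀ
    Sg-β₁   : ∀ {Γ} {A : Ty Γ} {B : Ty (Γ ▹ A)} {b : Tm Γ} {e : b ∶ A}
              {c : Tm Γ} {h : c ∶ B [ inst b e ]ᵀ} →
              fst (pair {B = B} b e c h) pair∶ ≡ b
    Sg-β₂   : ∀ {Γ} {A : Ty Γ} {B : Ty (Γ ▹ A)} {b : Tm Γ} {e : b ∶ A}
              {c : Tm Γ} {h : c ∶ B [ inst b e ]ᵀ} →
              snd (pair {B = B} b e c h) pair∶ ≡ c
    Sg-η    : ∀ {Γ} {A : Ty Γ} {B : Ty (Γ ▹ A)} {t : Tm Γ} {e : t ∶ Sg A B} →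
              pair (fst t e) fst∶ (snd t e) snd∶ ≡ t

    Id         : ∀ {Γ} (A : Ty Γ) (b c : Tm Γ) → b ∶ A → c ∶ A → Ty Γ
    Id-[]      : ∀ {Γ Δ} {A : Ty Δ} {b c : Tm Δ} {e : b ∶ A} {h : c ∶ A}
                 {σ : Sub Γ Δ} →
                 Id A b c e h [ σ ]ᵀ ≡
                 Id (A [ σ ]ᵀ) (b [ σ ]) (c [ σ ]) (∶-[] e σ) (∶-[] h σ)
    rfl        : ∀ {Γ} → Tm Γ → Tm Γ
    rfl∶       : ∀ {Γ} {A : Ty Γ} {b : Tm Γ} {e : b ∶ A} →
                 rfl b ∶ Id A b b e e
    reflection : ∀ {Γ} {A : Ty Γ} {b c t : Tm Γ} {e : b ∶ A} {h : c ∶ A} →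
                 t ∶ Id A b c e h → b ≡ c
    Id-irr     : ∀ {Γ} {A : Ty Γ} {b c t t′ : Tm Γ} {e : b ∶ A} {h : c ∶ A} →
                 t ∶ Id A b c e h → t′ ∶ Id A b c e h → t ≡ t′

    -- Universes à la Coquand: El and its inverse identify terms of U ℓ with
    -- the types of level ℓ.
    U      : ∀ {Γ} → ℕ → Ty Γ
    U-[]   : ∀ {Γ Δ} {ℓ} {σ : Sub Γ Δ} → U ℓ [ σ ]ᵀ ≡ U ℓ
    El     : ∀ {Γ} {ℓ} (c : Tm Γ) → c ∶ U ℓ → Ty Γ
    El-[]  : ∀ {Γ Δ} {ℓ} {c : Tm Δ} {e : c ∶ U ℓ} {σ : Sub Γ Δ} →
             El c e [ σ ]ᵀ ≡ El (c [ σ ]) (trans (∶-[] e σ) U-[])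
    El-inj : ∀ {Γ} {ℓ} {c d : Tm Γ} {e : c ∶ U ℓ} {h : d ∶ U ℓ} →
             El c e ≡ El d h → c ≡ d

  -- "A is a type of level ℓ".
  _∈U_ : ∀ {Γ} → Ty Γ → ℕ → Set a
  _∈U_ {Γ} A ℓ = Σ[ c ∈ Tm Γ ] Σ[ e ∈ c ∶ U ℓ ] El c e ≡ A

  ∈U-[] : ∀ {Γ Δ} {A : Ty Δ} {ℓ} → A ∈U ℓ → (σ : Sub Γ Δ) → A [ σ ]ᵀ ∈U ℓ
  ∈U-[] (c , e , h) σ =
    c [ σ ] , trans (∶-[] e σ) U-[] , trans (sym El-[]) (cong _[ σ ]ᵀ h)

  field
    cumul : ∀ {Γ} {A : Ty Γ} {ℓ ℓ′} → ℓ ≤ ℓ′ → A ∈U ℓ → A ∈U ℓ′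
    U-∈U  : ∀ {Γ} {ℓ} → U {Γ} ℓ ∈U suc ℓ
    Π-∈U  : ∀ {Γ} {A : Ty Γ} {B : Ty (Γ ▹ A)} {ℓ} →
            A ∈U ℓ → B ∈U ℓ → Π A B ∈U ℓ
    Sg-∈U : ∀ {Γ} {A : Ty Γ} {B : Ty (Γ ▹ A)} {ℓ} →
            A ∈U ℓ → B ∈U ℓ → Sg A B ∈U ℓ
    Id-∈U : ∀ {Γ} {A : Ty Γ} {b c : Tm Γ} {e : b ∶ A} {h : c ∶ A} {ℓ} →
            A ∈U ℓ → Id A b c e h ∈U ℓ

    -- The universe of propositions.
    Ω       : ∀ {Γ} → Ty Γ
    Ω-[]    : ∀ {Γ Δ} {σ : Sub Γ Δ} → Ω [ σ ]ᵀ ≡ Ω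
    Prf     : ∀ {Γ} (φ : Tm Γ) → φ ∶ Ω → Ty Γ
    Prf-[]  : ∀ {Γ Δ} {φ : Tm Δ} {e : φ ∶ Ω} {σ : Sub Γ Δ} →
              Prf φ e [ σ ]ᵀ ≡ Prf (φ [ σ ]) (trans (∶-[] e σ) Ω-[])
    Prf-∈U  : ∀ {Γ} {φ : Tm Γ} {e : φ ∶ Ω} → Prf φ e ∈U zero
    Prf-irr : ∀ {Γ} {φ b c : Tm Γ} {e : φ ∶ Ω} →
              b ∶ Prf φ e → c ∶ Prf φ e → b ≡ c
    -- Ω is a subobject classifier: a proposition is determined by the
    -- subobject it classifies, and every type A with at most one element
    -- (i.e. with wk : Γ ▹ A → Γ a monomorphism) is classified.
    propext : ∀ {Γ} {φ ψ : Tm Γ} {e : φ ∶ Ω} {h : ψ ∶ Ω}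
              {b : Tm (Γ ▹ Prf φ e)} {c : Tm (Γ ▹ Prf ψ h)} →
              b ∶ Prf ψ h [ wk ]ᵀ → c ∶ Prf φ e [ wk ]ᵀ → φ ≡ ψ
    χ       : ∀ {Γ} (A : Ty Γ) →
              vz {Γ ▹ A} {A [ wk ]ᵀ} ≡ vz {Γ} {A} [ wk ] → Tm Γ
    χ∶      : ∀ {Γ} {A : Ty Γ} {i} → χ A i ∶ Ω
    χ-to    : ∀ {Γ} {A : Ty Γ} {i} →
              Σ[ b ∈ Tm (Γ ▹ A) ] b ∶ Prf (χ A i) χ∶ [ wk ]ᵀ
    χ-from  : ∀ {Γ} {A : Ty Γ} {i} →
              Σ[ b ∈ Tm (Γ ▹ Prf (χ A i) χ∶) ] b ∶ A [ wk ]ᵀ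

  _⇒_ : ∀ {Γ} → Ty Γ → Ty Γ → Ty Γ
  A ⇒ B = Π A (B [ wk ]ᵀ)

  _×ᵀ_ : ∀ {Γ} → Ty Γ → Ty Γ → Ty Γ
  A ×ᵀ B = Sg A (B [ wk ]ᵀ)

  wk-[]ᵀ : ∀ {Γ Δ} {A B : Ty Δ} {σ : Sub Γ Δ} →
           B [ wk {A = A} ]ᵀ [ σ ↑ ]ᵀ ≡ B [ σ ]ᵀ [ wk ]ᵀ
  wk-[]ᵀ {B = B} = trans (sym [∘]ᵀ) (trans (cong (B [_]ᵀ) wk-ext) [∘]ᵀ)

  ⇒-[] : ∀ {Γ Δ} {A B : Ty Δ} {σ : Sub Γ Δ} →
         (A ⇒ B) [ σ ]ᵀ ≡ (A [ σ ]ᵀ ⇒ B [ σ ]ᵀ)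
  ⇒-[] {A = A} {σ = σ} = trans Π-[] (cong (Π (A [ σ ]ᵀ)) wk-[]ᵀ)

  -- (x : A) → Id A (g (f x)) x
  LeftInv : ∀ {Γ} {A B : Ty Γ} (f : Tm Γ) → f ∶ A ⇒ B →
            (g : Tm Γ) → g ∶ B ⇒ A → Ty Γ
  LeftInv {A = A} {B} f f∶ g g∶ =
    Π A (Id (A [ wk ]ᵀ) (app g g∶ [ f-x ]) vz
      (trans (∶-[] app∶ f-x) (trans (sym [∘]ᵀ) (cong (A [_]ᵀ) wk-ext))) vz∶)
    where
    f-x : Sub (_ ▹ A) (_ ▹ B)
    f-x = ext wk (app f f∶) app∶

  -- A ≅ B, i.e. (f : A ⇒ B) × (g : B ⇒ A) × g ∘ f = id × f ∘ g = id.
  -- Opaque only because unfolding it makes type checking very slow.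
  opaque
    Iso : ∀ {Γ} → Ty Γ → Ty Γ → Ty Γ
    Iso {Γ} A B =
      Sg (A ⇒ B) (Sg ((B ⇒ A) [ wk ]ᵀ) (LeftInv f f∶ g g∶ ×ᵀ LeftInv g g∶ f f∶))
      where
      Θ : Ctx
      Θ = Γ ▹ (A ⇒ B) ▹ (B ⇒ A) [ wk ]ᵀ
      f g : Tm Θ
      f = vz [ wk ]
      g = vz
      f∶ : f ∶ A [ wk ]ᵀ [ wk ]ᵀ ⇒ B [ wk ]ᵀ [ wk ]ᵀ
      f∶ = trans (∶-[] (trans vz∶ ⇒-[]) wk) ⇒-[]
      g∶ : g ∶ B [ wk ]ᵀ [ wk ]ᵀ ⇒ A [ wk ]ᵀ [ wk ]ᵀ
      g∶ = trans vz∶ (trans (cong _[ wk ]ᵀ ⇒-[]) ⇒-[])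

-- The strictness axiom at a mode.
module _ {a : Level} (M : ETT a) where
  open ETT M

  record StrictData (Γ : Ctx) (ℓ : ℕ) : Set a where
    field
      φ  : Tm Γ
      φ∶ : φ ∶ Ω
      A  : Tm Γ
      A∶ : A ∶ U ℓ
      T  : Tm (Γ ▹ Prf φ φ∶)
      T∶ : T ∶ U ℓ
      i  : Tm (Γ ▹ Prf φ φ∶)
      i∶ : i ∶ Iso (El A A∶ [ wk ]ᵀ) (El T T∶)

  record _≡_[_]ˢ {Γ Δ : Ctx} {ℓ : ℕ}
                 (D′ : StrictData Γ ℓ) (D : StrictData Δ ℓ) (σ : Sub Γ Δ) :
                 Set a where
    private
      module D′ = StrictData D′
      module D  = StrictData D
    field
      φ≡   : D′.φ ≡ D.φ [ σ ]
      A≡   : D′.A ≡ D.A [ σ ]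
      Prf≡ : Prf D′.φ D′.φ∶ ≡ Prf D.φ D.φ∶ [ σ ]ᵀ
      T≡   : D′.T ≡ D.T [ lift[ Prf≡ ] ]
      i≡   : D′.i ≡ D.i [ lift[ Prf≡ ] ]

  record Strictness : Set a where
    open StrictData
    field
      S    : ∀ {Γ ℓ} → StrictData Γ ℓ → Tm Γ
      S∶   : ∀ {Γ ℓ} {D : StrictData Γ ℓ} → S D ∶ U ℓ
      s    : ∀ {Γ ℓ} → StrictData Γ ℓ → Tm Γ
      s∶   : ∀ {Γ ℓ} {D : StrictData Γ ℓ} →
             s D ∶ Iso (El (A D) (A∶ D)) (El (S D) S∶)
      S-on : ∀ {Γ ℓ} {D : StrictData Γ ℓ} → S D [ wk ] ≡ T D
      s-on : ∀ {Γ ℓ} {D : StrictData Γ ℓ} → s D [ wk ] ≡ i D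
      S-[] : ∀ {Γ Δ ℓ} {D′ : StrictData Γ ℓ} {D : StrictData Δ ℓ}
             {σ : Sub Γ Δ} → D′ ≡ D [ σ ]ˢ → S D [ σ ] ≡ S D′
      s-[] : ∀ {Γ Δ ℓ} {D′ : StrictData Γ ℓ} {D : StrictData Δ ℓ}
             {σ : Sub Γ Δ} → D′ ≡ D [ σ ]ˢ → s D [ σ ] ≡ s D′

-- A modality μ : M → N.  Its lock functor goes in the opposite direction.
record Modality {a : Level} (M N : ETT a) : Set a where
  private
    module M = ETT M
    module N = ETT N
  field
    lock   : N.Ctx → M.Ctx
    lockˢ  : ∀ {Γ Δ} → N.Sub Γ Δ → M.Sub (lock Γ) (lock Δ)
    lock-id : ∀ {Γ} → lockˢ (N.id {Γ}) ≡ M.id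
    lock-∘  : ∀ {Γ Δ Θ} {σ : N.Sub Δ Θ} {τ : N.Sub Γ Δ} →
              lockˢ (σ N.∘ τ) ≡ lockˢ σ M.∘ lockˢ τ

    ⟨∣_⟩   : ∀ {Γ} → M.Ty (lock Γ) → N.Ty Γ
    ⟨∣⟩-[] : ∀ {Γ Δ} {A : M.Ty (lock Δ)} {σ : N.Sub Γ Δ} →
             ⟨∣ A ⟩ N.[ σ ]ᵀ ≡ ⟨∣ A M.[ lockˢ σ ]ᵀ ⟩
    ⟨∣⟩-∈U : ∀ {Γ} {A : M.Ty (lock Γ)} {ℓ} → A M.∈U ℓ → ⟨∣ A ⟩ N.∈U ℓ
    mod    : ∀ {Γ} → M.Tm (lock Γ) → N.Tm Γ
    mod∶   : ∀ {Γ} {A : M.Ty (lock Γ)} {b : M.Tm (lock Γ)} →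
             b M.∶ A → mod b N.∶ ⟨∣ A ⟩
    mod-[] : ∀ {Γ Δ} {b : M.Tm (lock Δ)} {σ : N.Sub Γ Δ} →
             mod b N.[ σ ] ≡ mod (b M.[ lockˢ σ ])

-- The modalities ∀ᵤ ⊣ 𝐭ᵤ between the modes X and Xu = (X, u : 𝕌), the
-- transpension type ⟨ 𝐭ᵤ ∣ A ⟩, and the boundary proposition u ∈ ∂𝕌.
record Transpension {a : Level} (X Xu : ETT a) : Set a where
  private
    module X  = ETT X
    module Xu = ETT Xu
  field
    ∀ᵤ : Modality Xu X
    𝐭ᵤ : Modality X Xu

  module L∀ = Modality ∀ᵤ
  module Lt = Modality 𝐭ᵤ

  field
    const     : ∀ {Δ} → X.Sub Δ (Lt.lock (L∀.lock Δ))
    const-nat : ∀ {Δ′ Δ} (σ : X.Sub Δ′ Δ) →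
                Lt.lockˢ (L∀.lockˢ σ) X.∘ const ≡ const X.∘ σ
    appˢ      : ∀ {Γ} → Xu.Sub (L∀.lock (Lt.lock Γ)) Γ
    appˢ-nat  : ∀ {Γ′ Γ} (σ : Xu.Sub Γ′ Γ) →
                appˢ Xu.∘ L∀.lockˢ (Lt.lockˢ σ) ≡ σ Xu.∘ appˢ
    triangle∀ : ∀ {Δ} → appˢ Xu.∘ L∀.lockˢ (const {Δ}) ≡ Xu.id
    triangle𝐭 : ∀ {Γ} → Lt.lockˢ (appˢ {Γ}) X.∘ const ≡ X.id

    unmerid  : ∀ {Δ} {A : X.Ty (Lt.lock (L∀.lock Δ))}
               (t : Xu.Tm (L∀.lock Δ)) → t Xu.∶ Lt.⟨∣ A ⟩ → X.Tm Δ
    unmerid∶ : ∀ {Δ} {A : X.Ty (Lt.lock (L∀.lock Δ))}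
               {t : Xu.Tm (L∀.lock Δ)} {e : t Xu.∶ Lt.⟨∣ A ⟩} →
               unmerid t e X.∶ A X.[ const ]ᵀ
    𝐭-β      : ∀ {Δ} {A : X.Ty (Lt.lock (L∀.lock Δ))}
               {b : X.Tm (Lt.lock (L∀.lock Δ))} (e : b X.∶ A) →
               unmerid (Lt.mod b) (Lt.mod∶ e) ≡ b X.[ const ]
    𝐭-η      : ∀ {Γ} {A : X.Ty (Lt.lock Γ)} {t : Xu.Tm Γ}
               (e : t Xu.∶ Lt.⟨∣ A ⟩) →
               t ≡ Lt.mod (unmerid (t Xu.[ appˢ ])
                                   (trans (Xu.∶-[] e appˢ) Lt.⟨∣⟩-[]))

    ∂   : ∀ {Γ} → Xu.Tm Γ
    ∂∶  : ∀ {Γ} → ∂ {Γ} Xu.∶ Xu.Ω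
    ∂-[] : ∀ {Γ Δ} {σ : Xu.Sub Γ Δ} → ∂ Xu.[ σ ] ≡ ∂

  u∈∂ : ∀ {Γ} → Xu.Ty Γ
  u∈∂ = Xu.Prf ∂ ∂∶

  field
    pole   : ∀ {Γ} (A : X.Ty (Lt.lock (Γ Xu.▹ u∈∂))) → Xu.Tm (Γ Xu.▹ u∈∂)
    pole∶  : ∀ {Γ} {A : X.Ty (Lt.lock (Γ Xu.▹ u∈∂))} →
             pole A Xu.∶ Lt.⟨∣ A ⟩
    pole-η : ∀ {Γ} {A : X.Ty (Lt.lock (Γ Xu.▹ u∈∂))}
             {t : Xu.Tm (Γ Xu.▹ u∈∂)} → t Xu.∶ Lt.⟨∣ A ⟩ → t ≡ pole A

  u∈∂-[] : ∀ {Γ Δ} {σ : Xu.Sub Γ Δ} → u∈∂ Xu.[ σ ]ᵀ ≡ u∈∂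
  u∈∂-[] = trans Xu.Prf-[] (Prf-cong ∂-[])
    where
    Prf-cong : ∀ {Γ} {φ ψ : Xu.Tm Γ} {e : φ Xu.∶ Xu.Ω} {h : ψ Xu.∶ Xu.Ω} →
               φ ≡ ψ → Xu.Prf φ e ≡ Xu.Prf ψ h
    Prf-cong {φ = φ} {e = e} {h} refl = cong (Xu.Prf φ) (uip e h)

-- The whole type system.  Modes are shape contexts, 𝕌 ∷ X being (X, u : 𝕌).
record TypeSystem (a : Level) : Set (lsuc a) where
  field
    Shape : Set a

  Mode : Set a
  Mode = List Shape

  field
    mode         : Mode → ETT a
    strictness   : ∀ X → Strictness (mode X)
    transpension : ∀ X 𝕌 → Transpension (mode X) (mode (𝕌 ∷ X))

-- The rules for the Ψ-type.
module _ {a : Level} {X Xu : ETT a} (𝐓 : Transpension X Xu) where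
  private
    module X  = ETT X
    module Xu = ETT Xu
  open Transpension 𝐓

  lift∂ : ∀ {Γ Δ} (σ : Xu.Sub Γ Δ) → Xu.Sub (Γ Xu.▹ u∈∂) (Δ Xu.▹ u∈∂)
  lift∂ σ = Xu.lift[_] {σ = σ} (sym u∈∂-[])

  -- (_ : u ∈ ∂𝕌) → A
  ∂Π : ∀ {Γ} → Xu.Ty (Γ Xu.▹ u∈∂) → Xu.Ty Γ
  ∂Π A = Xu.Π u∈∂ A

  ∂Π-[] : ∀ {Γ Δ} {A : Xu.Ty (Δ Xu.▹ u∈∂)} {σ : Xu.Sub Γ Δ} →
          ∂Π A Xu.[ σ ]ᵀ ≡ ∂Π (A Xu.[ lift∂ σ ]ᵀ)
  ∂Π-[] {A = A} {σ} = trans Xu.Π-[] (lemma refl (sym u∈∂-[]))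
    where
    lemma : ∀ {B C} (e : B ≡ u∈∂ Xu.[ σ ]ᵀ) (h : C ≡ u∈∂ Xu.[ σ ]ᵀ) →
            Xu.Π B (A Xu.[ Xu.lift[ e ] ]ᵀ) ≡ Xu.Π C (A Xu.[ Xu.lift[ h ] ]ᵀ)
    lemma refl refl = refl

  -- The premises of the formation rule; every type has some universe level.
  record ΨData (Γ : Xu.Ctx) : Set a where
    field
      A    : Xu.Ty (Γ Xu.▹ u∈∂)
      ℓA   : ℕ
      A∈U  : A Xu.∈U ℓA
      R    : X.Ty (Lt.lock (Γ Xu.▹ ∂Π A))
      ℓR   : ℕ
      R∈U  : R X.∈U ℓR

    R[_,_] : (f : Xu.Tm Γ) → f Xu.∶ ∂Π A → X.Ty (Lt.lock Γ)
    R[ f , e ] = R X.[ Lt.lockˢ (Xu.inst f e) ]ᵀ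

  open ΨData

  _[_]ᴰ : ∀ {Γ Δ} → ΨData Δ → Xu.Sub Γ Δ → ΨData Γ
  D [ σ ]ᴰ = record
    { A   = A D Xu.[ lift∂ σ ]ᵀ
    ; ℓA  = ℓA D
    ; A∈U = Xu.∈U-[] (A∈U D) (lift∂ σ)
    ; R   = R D X.[ σ′ ]ᵀ
    ; ℓR  = ℓR D
    ; R∈U = X.∈U-[] (R∈U D) σ′
    }
    where
    σ′ = Lt.lockˢ (Xu.lift[_] {A = ∂Π (A D)} {σ = σ} (sym ∂Π-[]))

  record ΨType : Set a where
    field
      Ψ    : ∀ {Γ} → ΨData Γ → Xu.Ty Γ
      Ψ-∈U : ∀ {Γ} (D : ΨData Γ) → Ψ D Xu.∈U (ℓA D ⊔ ℓR D)
      Ψ-[] : ∀ {Γ Δ} (D : ΨData Δ) (σ : Xu.Sub Γ Δ) →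
             Ψ D Xu.[ σ ]ᵀ ≡ Ψ (D [ σ ]ᴰ)
      Ψ-on : ∀ {Γ} (D : ΨData Γ) → Ψ D Xu.[ Xu.wk ]ᵀ ≡ A D

    on∂ : ∀ {Γ} (D : ΨData Γ) {q : Xu.Tm Γ} → q Xu.∶ Ψ D →
          q Xu.[ Xu.wk ] Xu.∶ A D
    on∂ D e = trans (Xu.∶-[] e Xu.wk) (Ψ-on D)

    Ψ∶-[] : ∀ {Γ Δ} (D : ΨData Δ) {q : Xu.Tm Δ} → q Xu.∶ Ψ D →
            (σ : Xu.Sub Γ Δ) → q Xu.[ σ ] Xu.∶ Ψ (D [ σ ]ᴰ)
    Ψ∶-[] D e σ = trans (Xu.∶-[] e σ) (Ψ-[] D σ)

    field
      inΨ    : ∀ {Γ} (D : ΨData Γ)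
               (b : Xu.Tm (Γ Xu.▹ u∈∂)) (b∶ : b Xu.∶ A D)
               (r : X.Tm (Lt.lock Γ)) → r X.∶ R[_,_] D (Xu.lam b) (Xu.lam∶ b∶) →
               Xu.Tm Γ
      inΨ∶   : ∀ {Γ} (D : ΨData Γ) {b} (b∶ : b Xu.∶ A D)
               {r} (r∶ : r X.∶ R[_,_] D (Xu.lam b) (Xu.lam∶ b∶)) →
               inΨ D b b∶ r r∶ Xu.∶ Ψ D
      inΨ-[] : ∀ {Γ Δ} (D : ΨData Δ) {b} (b∶ : b Xu.∶ A D)
               {r} (r∶ : r X.∶ R[_,_] D (Xu.lam b) (Xu.lam∶ b∶))
               (σ : Xu.Sub Γ Δ) →
               let b∶′ = Xu.∶-[] b∶ (lift∂ σ) in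
               Σ[ r∶′ ∈ r X.[ Lt.lockˢ σ ] X.∶
                        R[_,_] (D [ σ ]ᴰ) (Xu.lam (b Xu.[ lift∂ σ ]))
                               (Xu.lam∶ b∶′) ]
               inΨ D b b∶ r r∶ Xu.[ σ ] ≡
               inΨ (D [ σ ]ᴰ) (b Xu.[ lift∂ σ ]) b∶′ (r X.[ Lt.lockˢ σ ]) r∶′
      inΨ-on : ∀ {Γ} (D : ΨData Γ) {b} (b∶ : b Xu.∶ A D)
               {r} (r∶ : r X.∶ R[_,_] D (Xu.lam b) (Xu.lam∶ b∶)) →
               inΨ D b b∶ r r∶ Xu.[ Xu.wk ] ≡ b

      outΨ    : ∀ {Δ} (D : ΨData (L∀.lock Δ)) (q : Xu.Tm (L∀.lock Δ)) →
                q Xu.∶ Ψ D → X.Tm Δ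
      outΨ∶   : ∀ {Δ} (D : ΨData (L∀.lock Δ)) {q} (q∶ : q Xu.∶ Ψ D) →
                outΨ D q q∶ X.∶
                R[_,_] D (Xu.lam (q Xu.[ Xu.wk ])) (Xu.lam∶ (on∂ D q∶))
                  X.[ const ]ᵀ
      outΨ-[] : ∀ {Δ′ Δ} (D : ΨData (L∀.lock Δ)) {q} (q∶ : q Xu.∶ Ψ D)
                (σ : X.Sub Δ′ Δ) →
                outΨ D q q∶ X.[ σ ] ≡
                outΨ (D [ L∀.lockˢ σ ]ᴰ) (q Xu.[ L∀.lockˢ σ ])
                     (Ψ∶-[] D q∶ (L∀.lockˢ σ))

      Ψ-β : ∀ {Δ} (D : ΨData (L∀.lock Δ)) {b} (b∶ : b Xu.∶ A D)
            {r} (r∶ : r X.∶ R[_,_] D (Xu.lam b) (Xu.lam∶ b∶)) →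
            outΨ D (inΨ D b b∶ r r∶) (inΨ∶ D b∶ r∶) ≡ r X.[ const ]
      -- That outΨ (q [ appˢ ]) has the type demanded by inΨ is part of the
      -- claim.
      Ψ-η : ∀ {Γ} (D : ΨData Γ) {q} (q∶ : q Xu.∶ Ψ D) →
            let r = outΨ (D [ appˢ ]ᴰ) (q Xu.[ appˢ ]) (Ψ∶-[] D q∶ appˢ) in
            Σ[ r∶ ∈ r X.∶ R[_,_] D (Xu.lam (q Xu.[ Xu.wk ]))
                                   (Xu.lam∶ (on∂ D q∶)) ]
            q ≡ inΨ D (q Xu.[ Xu.wk ]) (on∂ D q∶) r r∶

{-# OPTIONS --safe #-}

-- Ψ is the pair type Total = Σ (x̂ : (_ : u ∈ ∂𝕌) → A) ⟨ 𝐭ᵤ ∣ R ⟩, strictified.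
-- On the boundary ⟨ 𝐭ᵤ ∣ R ⟩ has a unique element, so applying the first
-- component to the proof of u ∈ ∂𝕌 is an isomorphism Total ≅ A there, and the
-- strictness axiom yields a type equal to A on the boundary and isomorphic to
-- Total everywhere.  Transporting pairs (λ _ . a , mod r) along this
-- isomorphism gives inΨ, and unmerid of the second component gives outΨ.
-- Stability of the isomorphism on the boundary under substitution is reduced
-- to that of its forward map, since inverses are unique and identity proofs
-- are irrelevant.
module Submission where

open import Defs
open import Axiom.UniquenessOfIdentityProofs.WithK using (uip)
open import Data.List using (_∷_)
open import Data.Nat using (_⊔_; z≤n)
open import Data.Nat.Properties using (m≤m⊔n; m≤n⊔m)
open import Data.Product using (Σ-syntax; _×_; _,_; proj₁; proj₂)
open import Level using (Level)
open import Relation.Binary.PropositionalEquality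
  using (_≡_; refl; sym; trans; cong; cong₂; module ≡-Reasoning)

-- Substitution calculus at a single mode.

module ETT-Properties {a : Level} (M : ETT a) where
  open ETT M

  vz-[]∶ : ∀ {Γ Δ} {A : Ty Δ} (τ : Sub Γ (Δ ▹ A)) → vz [ τ ] ∶ A [ wk ∘ τ ]ᵀ
  vz-[]∶ τ = trans (∶-[] vz∶ τ) (sym [∘]ᵀ)

  ext-cong : ∀ {Γ Δ} {A : Ty Δ} {σ σ′ : Sub Γ Δ} {b b′ : Tm Γ}
             {e : b ∶ A [ σ ]ᵀ} {e′ : b′ ∶ A [ σ′ ]ᵀ} →
             σ ≡ σ′ → b ≡ b′ → ext {A = A} σ b e ≡ ext σ′ b′ e′
  ext-cong {σ = σ} {b = b} {e = e} {e′} refl refl = cong (ext σ b) (uip e e′)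

  -- `ext-η` rebuilds both substitutions from their components, and `ext-cong` absorbs the
  -- difference between the typing proofs.
  Sub-ext : ∀ {Γ Δ} {A : Ty Δ} {τ τ′ : Sub Γ (Δ ▹ A)} →
            wk ∘ τ ≡ wk ∘ τ′ → vz [ τ ] ≡ vz [ τ′ ] → τ ≡ τ′
  Sub-ext {τ = τ} {τ′} p q =
    trans (sym (ext-η (vz-[]∶ τ))) (trans (ext-cong p q) (ext-η (vz-[]∶ τ′)))

  []-cong : ∀ {Γ Δ} {b b′ : Tm Δ} {σ : Sub Γ Δ} → b ≡ b′ → b [ σ ] ≡ b′ [ σ ]
  []-cong refl = refl

  []ᵀ-cong : ∀ {Γ Δ} {A A′ : Ty Δ} {σ : Sub Γ Δ} → A ≡ A′ → A [ σ ]ᵀ ≡ A′ [ σ ]ᵀ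
  []ᵀ-cong refl = refl

  []-congˢ : ∀ {Γ Δ} {b : Tm Δ} {σ τ : Sub Γ Δ} → σ ≡ τ → b [ σ ] ≡ b [ τ ]
  []-congˢ refl = refl

  []ᵀ-congˢ : ∀ {Γ Δ} {A : Ty Δ} {σ τ : Sub Γ Δ} → σ ≡ τ → A [ σ ]ᵀ ≡ A [ τ ]ᵀ
  []ᵀ-congˢ refl = refl

  ∘-congʳ : ∀ {Γ Δ Θ} {σ : Sub Δ Θ} {τ τ′ : Sub Γ Δ} → τ ≡ τ′ → σ ∘ τ ≡ σ ∘ τ′
  ∘-congʳ refl = refl

  wk-ext-∘ : ∀ {Γ Δ Θ} {A : Ty Δ} {σ : Sub Γ Δ} {b : Tm Γ}
             {e : b ∶ A [ σ ]ᵀ} {τ : Sub Θ Γ} →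
             wk ∘ (ext {A = A} σ b e ∘ τ) ≡ σ ∘ τ
  wk-ext-∘ = trans (sym assoc) (cong (_∘ _) wk-ext)

  vz-ext-∘ : ∀ {Γ Δ Θ} {A : Ty Δ} {σ : Sub Γ Δ} {b : Tm Γ}
             {e : b ∶ A [ σ ]ᵀ} {τ : Sub Θ Γ} →
             vz [ ext {A = A} σ b e ∘ τ ] ≡ b [ τ ]
  vz-ext-∘ = trans [∘] (cong _[ _ ] vz-ext)

  -- The domain equations are arbitrary because `u∈∂` and `∂Π` are stable under substitution only
  -- propositionally. The later lemmas about `lift[_]` take such equations for the same reason.
  lift-∘ : ∀ {Γ Δ Θ} {A : Ty Θ} {A′ : Ty Δ} {A″ : Ty Γ}
           {σ : Sub Δ Θ} {τ : Sub Γ Δ} (p : A′ ≡ A [ σ ]ᵀ) (q : A″ ≡ A′ [ τ ]ᵀ)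
           (r : A″ ≡ A [ σ ∘ τ ]ᵀ) →
           lift[_] {σ = σ} p ∘ lift[_] {σ = τ} q ≡ lift[_] {σ = σ ∘ τ} r
  lift-∘ p q r = Sub-ext
    (trans wk-ext-∘ (trans assoc (trans (cong (_ ∘_) wk-ext)
      (trans (sym assoc) (sym wk-ext)))))
    (trans vz-ext-∘ (trans vz-ext (sym vz-ext)))

  lift-id : ∀ {Γ} {A : Ty Γ} (p : A ≡ A [ id ]ᵀ) → lift[_] {σ = id} p ≡ id
  lift-id p = Sub-ext (trans wk-ext (trans idˡ (sym idʳ))) (trans vz-ext (sym [id]))

  ∘-inst : ∀ {Γ Δ} {A : Ty Δ} {A′ : Ty Γ} {σ : Sub Γ Δ} {b : Tm Δ} {b′ : Tm Γ}
           {e : b ∶ A} {e′ : b′ ∶ A′} (p : A′ ≡ A [ σ ]ᵀ) → b′ ≡ b [ σ ] →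
           inst b e ∘ σ ≡ lift[_] {σ = σ} p ∘ inst b′ e′
  ∘-inst p q = Sub-ext
    (trans wk-ext-∘ (trans (trans idˡ (sym idʳ))
      (sym (trans wk-ext-∘ (trans assoc (cong (_ ∘_) wk-ext))))))
    (trans vz-ext-∘ (trans (sym q) (sym (trans vz-ext-∘ vz-ext))))

  lift-inst : ∀ {Γ Δ} {A : Ty Δ} {A′ : Ty Γ} {σ : Sub Γ Δ} {b : Tm Γ}
              {e : b ∶ A′} (p : A′ ≡ A [ σ ]ᵀ) (h : b ∶ A [ σ ]ᵀ) →
              lift[_] {σ = σ} p ∘ inst b e ≡ ext σ b h
  lift-inst p h = Sub-ext
    (trans wk-ext-∘ (trans assoc (trans (cong (_ ∘_) wk-ext) (trans idʳ (sym wk-ext)))))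
    (trans vz-ext-∘ (trans vz-ext (sym vz-ext)))

  inst-cong : ∀ {Γ} {A : Ty Γ} {b b′ : Tm Γ} {e : b ∶ A} {e′ : b′ ∶ A} →
              b ≡ b′ → inst b e ≡ inst b′ e′
  inst-cong = ext-cong refl

  -- The diagonal `x ↦ (x , x)` followed by forgetting the earlier copy.
  inst-vz : ∀ {Γ} {A : Ty Γ} {A′ : Ty (Γ ▹ A)} {e : vz ∶ A′}
            (p : A′ ≡ A [ wk ]ᵀ) → lift[_] {σ = wk} p ∘ inst vz e ≡ id
  inst-vz p = Sub-ext
    (trans wk-ext-∘ (trans assoc (cong (_ ∘_) wk-ext)))
    (trans vz-ext-∘ (trans vz-ext (sym [id])))

  wk-instᵀ : ∀ {Γ} {A B : Ty Γ} {b : Tm Γ} {e : b ∶ A} →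
             B [ wk ]ᵀ [ inst b e ]ᵀ ≡ B
  wk-instᵀ = trans (sym [∘]ᵀ) (trans ([]ᵀ-congˢ wk-ext) [id]ᵀ)

  wk-inst : ∀ {Γ} {A : Ty Γ} {b c : Tm Γ} {e : b ∶ A} → c [ wk ] [ inst b e ] ≡ c
  wk-inst = trans (sym [∘]) (trans ([]-congˢ wk-ext) [id])

  []ᵀ-∘≡ : ∀ {Γ Δ Δ′ Θ} {A : Ty Θ} {σ : Sub Δ Θ} {τ : Sub Γ Δ}
           {σ′ : Sub Δ′ Θ} {τ′ : Sub Γ Δ′} → σ ∘ τ ≡ σ′ ∘ τ′ →
           A [ σ ]ᵀ [ τ ]ᵀ ≡ A [ σ′ ]ᵀ [ τ′ ]ᵀ
  []ᵀ-∘≡ p = trans (sym [∘]ᵀ) (trans ([]ᵀ-congˢ p) [∘]ᵀ)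

  []-∘≡ : ∀ {Γ Δ Δ′ Θ} {b : Tm Θ} {σ : Sub Δ Θ} {τ : Sub Γ Δ}
          {σ′ : Sub Δ′ Θ} {τ′ : Sub Γ Δ′} → σ ∘ τ ≡ σ′ ∘ τ′ →
          b [ σ ] [ τ ] ≡ b [ σ′ ] [ τ′ ]
  []-∘≡ p = trans (sym [∘]) (trans ([]-congˢ p) [∘])

  -- Stability of Π, Σ and their terms under substitution.

  Sg-lift : ∀ {Γ Δ} {A : Ty Δ} {A′ : Ty Γ} {B : Ty (Δ ▹ A)} {σ : Sub Γ Δ}
           (p : A′ ≡ A [ σ ]ᵀ) → Sg A B [ σ ]ᵀ ≡ Sg A′ (B [ lift[ p ] ]ᵀ)
  Sg-lift refl = Sg-[]

  lam-lift : ∀ {Γ Δ} {A : Ty Δ} {A′ : Ty Γ} {b : Tm (Δ ▹ A)} {σ : Sub Γ Δ}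
             (p : A′ ≡ A [ σ ]ᵀ) → lam b [ σ ] ≡ lam (b [ lift[ p ] ])
  lam-lift refl = lam-[]

  app-cong : ∀ {Γ} {A : Ty Γ} {B B′ : Ty (Γ ▹ A)} {f f′ : Tm Γ}
             {e : f ∶ Π A B} {e′ : f′ ∶ Π A B′} →
             B ≡ B′ → f ≡ f′ → app f e ≡ app f′ e′
  app-cong {f = f} {e = e} {e′} refl refl = cong (app f) (uip e e′)

  -- `Π-β` writes the substituted body as an application of its own abstraction, and `lam-lift` with
  -- `Π-η` identifies that abstraction with `f [ σ ]`.
  app-lift : ∀ {Γ Δ} {A : Ty Δ} {A′ : Ty Γ} {B : Ty (Δ ▹ A)} {B′ : Ty (Γ ▹ A′)}
             {σ : Sub Γ Δ} {f : Tm Δ} {f′ : Tm Γ} {e : f ∶ Π A B} {e′ : f′ ∶ Π A′ B′}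
             (p : A′ ≡ A [ σ ]ᵀ) → B′ ≡ B [ lift[ p ] ]ᵀ → f′ ≡ f [ σ ] →
             app f e [ lift[ p ] ] ≡ app f′ e′
  app-lift {e = e} p q r =
    trans (sym (Π-β (∶-[] (app∶ {e = e}) lift[ p ])))
      (app-cong (sym q)
        (trans (sym (lam-lift p)) (trans (cong _[ _ ] Π-η) (sym r))))

  pair-cong : ∀ {Γ} {A : Ty Γ} {B B′ : Ty (Γ ▹ A)} {b b′ c c′ : Tm Γ}
              {e : b ∶ A} {e′ : b′ ∶ A} {h : c ∶ B [ inst b e ]ᵀ}
              {h′ : c′ ∶ B′ [ inst b′ e′ ]ᵀ} → B ≡ B′ → b ≡ b′ → c ≡ c′ →
              pair {B = B} b e c h ≡ pair {B = B′} b′ e′ c′ h′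
  pair-cong {b = b} {c = c} {e = e} {e′} {h} {h′} refl refl refl
    with refl ← uip e e′ = cong (pair b e c) (uip h h′)

  fst-cong : ∀ {Γ} {A : Ty Γ} {B B′ : Ty (Γ ▹ A)} {t t′ : Tm Γ}
             {e : t ∶ Sg A B} {e′ : t′ ∶ Sg A B′} →
             B ≡ B′ → t ≡ t′ → fst t e ≡ fst t′ e′
  fst-cong {t = t} {e = e} {e′} refl refl = cong (fst t) (uip e e′)

  snd-cong : ∀ {Γ} {A : Ty Γ} {B B′ : Ty (Γ ▹ A)} {t t′ : Tm Γ}
             {e : t ∶ Sg A B} {e′ : t′ ∶ Sg A B′} →
             B ≡ B′ → t ≡ t′ → snd t e ≡ snd t′ e′
  snd-cong {t = t} {e = e} {e′} refl refl = cong (snd t) (uip e e′)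

  Sg-ext : ∀ {Γ} {A : Ty Γ} {B : Ty (Γ ▹ A)} {t t′ : Tm Γ}
           {e : t ∶ Sg A B} {e′ : t′ ∶ Sg A B} →
           fst t e ≡ fst t′ e′ → snd t e ≡ snd t′ e′ → t ≡ t′
  Sg-ext p q = trans (sym Sg-η) (trans (pair-cong refl p q) Sg-η)

  pair-lift : ∀ {Γ Δ} {A : Ty Δ} {A′ : Ty Γ} {B : Ty (Δ ▹ A)} {B′ : Ty (Γ ▹ A′)}
              {σ : Sub Γ Δ} {b c : Tm Δ} {b′ c′ : Tm Γ}
              {e : b ∶ A} {h : c ∶ B [ inst b e ]ᵀ}
              {e′ : b′ ∶ A′} {h′ : c′ ∶ B′ [ inst b′ e′ ]ᵀ}
              (p : A′ ≡ A [ σ ]ᵀ) → B′ ≡ B [ lift[ p ] ]ᵀ →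
              b′ ≡ b [ σ ] → c′ ≡ c [ σ ] →
              pair {B = B} b e c h [ σ ] ≡ pair {B = B′} b′ e′ c′ h′
  pair-lift {e′ = e′} {h′} refl refl refl refl = pair-[] e′ h′

  module _ {Γ Δ} {A : Ty Δ} {A′ : Ty Γ} {B : Ty (Δ ▹ A)} {B′ : Ty (Γ ▹ A′)}
           {σ : Sub Γ Δ} {t : Tm Δ} {t′ : Tm Γ} {e : t ∶ Sg A B} {e′ : t′ ∶ Sg A′ B′}
           (p : A′ ≡ A [ σ ]ᵀ) (q : B′ ≡ B [ lift[ p ] ]ᵀ) (r : t′ ≡ t [ σ ]) where
    private
      e₁ : fst t e [ σ ] ∶ A′
      e₁ = trans (∶-[] fst∶ σ) (sym p)
      e₂ : snd t e [ σ ] ∶ B′ [ inst (fst t e [ σ ]) e₁ ]ᵀ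
      e₂ = trans (∶-[] snd∶ σ)
        (trans ([]ᵀ-∘≡ (∘-inst {e′ = e₁} p refl)) (cong _[ inst _ e₁ ]ᵀ (sym q)))

      pair≡ : pair (fst t e [ σ ]) e₁ (snd t e [ σ ]) e₂ ≡ t′
      pair≡ = trans (sym (pair-lift p q refl refl)) (trans (cong _[ σ ] Sg-η) (sym r))

    -- By `Sg-η` and `pair-lift`, `t′` is the pair of the substituted projections, so the β-laws
    -- give this and `snd-lift`.
    fst-lift : fst t e [ σ ] ≡ fst t′ e′
    fst-lift = trans (sym Sg-β₁) (fst-cong refl pair≡)

    snd-lift : snd t e [ σ ] ≡ snd t′ e′
    snd-lift = trans (sym Sg-β₂) (snd-cong refl pair≡)

  -- Identity types, universe membership and left inverses.

  Id-cong : ∀ {Γ} {A A′ : Ty Γ} {b b′ c c′ : Tm Γ} {e : b ∶ A} {e′ : b′ ∶ A′}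
            {h : c ∶ A} {h′ : c′ ∶ A′} → A ≡ A′ → b ≡ b′ → c ≡ c′ →
            Id A b c e h ≡ Id A′ b′ c′ e′ h′
  Id-cong {A = A} {b = b} {c = c} {e = e} {e′} {h} {h′} refl refl refl
    with refl ← uip e e′ = cong (Id A b c e) (uip h h′)

  El-cong : ∀ {Γ ℓ} {c d : Tm Γ} {e : c ∶ U ℓ} {h : d ∶ U ℓ} →
            c ≡ d → El c e ≡ El d h
  El-cong {c = c} {e = e} {h} refl = cong (El c) (uip e h)

  -- `El-inj` forces the codes to agree, and the other components are equality proofs. Hence
  -- comparing data for Ψ never involves the chosen codes.
  ∈U-irr : ∀ {Γ} {A : Ty Γ} {ℓ} (p q : A ∈U ℓ) → p ≡ q
  ∈U-irr (c , e , h) (d , e′ , h′) with refl ← El-inj (trans h (sym h′))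
    with refl ← uip e e′ = cong (λ k → c , e , k) (uip h h′)

  ×ᵀ-[] : ∀ {Γ Δ} {A B : Ty Δ} {σ : Sub Γ Δ} →
          (A ×ᵀ B) [ σ ]ᵀ ≡ (A [ σ ]ᵀ ×ᵀ B [ σ ]ᵀ)
  ×ᵀ-[] {A = A} {σ = σ} = trans Sg-[] (cong (Sg (A [ σ ]ᵀ)) wk-[]ᵀ)

  ×ᵀ-cong : ∀ {Γ} {A A′ B B′ : Ty Γ} → A ≡ A′ → B ≡ B′ → (A ×ᵀ B) ≡ (A′ ×ᵀ B′)
  ×ᵀ-cong refl refl = refl

  LeftInv-lift : ∀ {Γ Δ} {A B : Ty Δ} {A′ B′ : Ty Γ} {σ : Sub Γ Δ}
                 {f g : Tm Δ} {f′ g′ : Tm Γ}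
                 {f∶ : f ∶ A ⇒ B} {g∶ : g ∶ B ⇒ A}
                 {f′∶ : f′ ∶ A′ ⇒ B′} {g′∶ : g′ ∶ B′ ⇒ A′} →
                 A′ ≡ A [ σ ]ᵀ → B′ ≡ B [ σ ]ᵀ → f′ ≡ f [ σ ] → g′ ≡ g [ σ ] →
                 LeftInv f f∶ g g∶ [ σ ]ᵀ ≡ LeftInv f′ f′∶ g′ g′∶
  LeftInv-lift {σ = σ} {f∶ = f∶} {f′∶ = f′∶} refl refl p q =
    trans Π-[] (cong (Π _) (trans Id-[] (Id-cong wk-[]ᵀ
      (trans ([]-∘≡ comm) ([]-cong (app-lift refl (sym wk-[]ᵀ) q)))
      vz-ext)))
    where
    -- Substitution by `σ` commutes with replacing the variable `x` by `f x`.
    comm : ext wk (app _ f∶) app∶ ∘ σ ↑ ≡ σ ↑ ∘ ext wk (app _ f′∶) app∶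
    comm = Sub-ext
      (trans wk-ext-∘ (trans wk-ext (sym (trans wk-ext-∘
        (trans assoc (cong (σ ∘_) wk-ext))))))
      (trans vz-ext-∘ (trans (app-lift refl (sym wk-[]ᵀ) p)
        (sym (trans vz-ext-∘ vz-ext))))

  module _ {Γ} {A B : Ty Γ} {f g : Tm Γ} {f∶ : f ∶ A ⇒ B} {g∶ : g ∶ B ⇒ A} where

    LeftInv-sound : ∀ {t} → t ∶ LeftInv f f∶ g g∶ →
                    app g g∶ [ ext wk (app f f∶) app∶ ] ≡ vz
    LeftInv-sound t∶ = reflection (app∶ {e = t∶})

    LeftInv-intro : app g g∶ [ ext wk (app f f∶) app∶ ] ≡ vz →
                    lam (rfl vz) ∶ LeftInv f f∶ g g∶
    LeftInv-intro p = lam∶ (trans (rfl∶ {e = vz∶}) (Id-cong refl (sym p) refl))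

    -- `Π-η` reduces the claim to the bodies, which are identity proofs.
    LeftInv-irr : ∀ {t t′} → t ∶ LeftInv f f∶ g g∶ → t′ ∶ LeftInv f f∶ g g∶ → t ≡ t′
    LeftInv-irr t∶ t′∶ =
      trans (sym Π-η) (trans (cong lam (Id-irr (app∶ {e = t∶}) (app∶ {e = t′∶}))) Π-η)

  -- Triples in iterated Σ-types.

  module _ {Γ} {A : Ty Γ} {B : Ty (Γ ▹ A)} {C : Ty (Γ ▹ A ▹ B)} where

    Sg³-pair : (b c d : Tm Γ) (e : b ∶ A) (h : c ∶ B [ inst b e ]ᵀ) →
               d ∶ C [ ext (inst b e) c h ]ᵀ →
               Σ[ t ∈ Tm Γ ] Σ[ t∶ ∈ t ∶ Sg A (Sg B C) ] fst t t∶ ≡ b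
    Sg³-pair b c d e h k = _ , _ , Sg-β₁ {b = b} {e} {h =
      trans (pair∶ {b = c} {h} {d} {trans k
        (sym (trans (sym [∘]ᵀ) ([]ᵀ-congˢ (lift-inst refl h))))})
      (sym Sg-[])}

    module _ {t : Tm Γ} (t∶ : t ∶ Sg A (Sg B C)) where
      Sg³-π₂ : Tm Γ
      Sg³-π₂ = fst (snd t t∶) (trans snd∶ Sg-[])

      Sg³-π₂∶ : Sg³-π₂ ∶ B [ inst (fst t t∶) fst∶ ]ᵀ
      Sg³-π₂∶ = fst∶

      Sg³-π₃ : Tm Γ
      Sg³-π₃ = snd (snd t t∶) (trans snd∶ Sg-[])

      Sg³-π₃∶ : Sg³-π₃ ∶ C [ ext (inst (fst t t∶) fst∶) Sg³-π₂ Sg³-π₂∶ ]ᵀ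
      Sg³-π₃∶ = trans snd∶ (trans (sym [∘]ᵀ) ([]ᵀ-congˢ (lift-inst refl Sg³-π₂∶)))

    Sg³-ext : ∀ {t t′} {t∶ : t ∶ Sg A (Sg B C)} {t′∶ : t′ ∶ Sg A (Sg B C)} →
              fst t t∶ ≡ fst t′ t′∶ → Sg³-π₂ t∶ ≡ Sg³-π₂ t′∶ →
              Sg³-π₃ t∶ ≡ Sg³-π₃ t′∶ → t ≡ t′
    -- The first components must be generalised to variables before their equality can be matched
    -- with `refl`; only then do the types of the remaining pairs coincide.
    Sg³-ext {t} {t′} {t∶} {t′∶} p q r = Sg-ext p (step p q r)
      where
      step : ∀ {b b′ s s′ : Tm Γ} {e : b ∶ A} {e′ : b′ ∶ A}
             {h : s ∶ Sg _ (C [ inst b e ↑ ]ᵀ)} {h′ : s′ ∶ Sg _ (C [ inst b′ e′ ↑ ]ᵀ)} →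
             b ≡ b′ → fst s h ≡ fst s′ h′ → snd s h ≡ snd s′ h′ → s ≡ s′
      step {e = e} {e′} refl with refl ← uip e e′ = Sg-ext

-- Isomorphism types and the uniqueness of inverses.

module Isomorphisms {a : Level} (M : ETT a) where
  open ETT M
  open ETT-Properties M

  opaque
    unfolding Iso

    -- IsoLaws is read off from the definition of Iso by unification in Iso≡Sg³.
    IsoLaws : ∀ {Γ} (A B : Ty Γ) → Ty (Γ ▹ (A ⇒ B) ▹ (B ⇒ A) [ wk ]ᵀ)
    Iso≡Sg³ : ∀ {Γ} (A B : Ty Γ) →
              Iso A B ≡ Sg (A ⇒ B) (Sg ((B ⇒ A) [ wk ]ᵀ) (IsoLaws A B))

    IsoLaws A B = _
    Iso≡Sg³ A B = refl

    IsoLaws-inst : ∀ {Γ} {A B : Ty Γ} {f g : Tm Γ} {f∶ : f ∶ A ⇒ B}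
                   (g∶ : g ∶ B ⇒ A) (h : g ∶ (B ⇒ A) [ wk ]ᵀ [ inst f f∶ ]ᵀ) →
                   IsoLaws A B [ ext (inst f f∶) g h ]ᵀ
                   ≡ (LeftInv f f∶ g g∶ ×ᵀ LeftInv g g∶ f f∶)
    IsoLaws-inst {Γ} {A} {B} {f} {g} {f∶} g∶ h =
      trans ×ᵀ-[] (×ᵀ-cong (LeftInv-lift []ρ []ρ f≡ (sym vz-ext))
                           (LeftInv-lift []ρ []ρ (sym vz-ext) f≡))
      where
      ρ : Sub Γ (Γ ▹ (A ⇒ B) ▹ (B ⇒ A) [ wk ]ᵀ)
      ρ = ext (inst f f∶) g h

      []ρ : ∀ {C} → C ≡ C [ wk ]ᵀ [ wk ]ᵀ [ ρ ]ᵀ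
      []ρ = sym (trans (sym [∘]ᵀ) (trans ([]ᵀ-congˢ wk-ext) wk-instᵀ))

      f≡ : f ≡ vz [ wk ] [ ρ ]
      f≡ = sym (trans (sym [∘]) (trans ([]-congˢ wk-ext) vz-ext))

  module _ {Γ : Ctx} {A B : Ty Γ} where
    module _ {t : Tm Γ} (t∶ : t ∶ Iso A B) where
      opaque
        iso∶ : t ∶ Sg (A ⇒ B) (Sg ((B ⇒ A) [ wk ]ᵀ) (IsoLaws A B))
        iso∶ = trans t∶ (Iso≡Sg³ A B)

        π₂∶ : Sg³-π₂ iso∶ ∶ B ⇒ A
        π₂∶ = trans (Sg³-π₂∶ iso∶) wk-instᵀ

        π₃∶ : Sg³-π₃ iso∶ ∶ LeftInv (fst t iso∶) fst∶ _ π₂∶ ×ᵀ LeftInv _ π₂∶ (fst t iso∶) fst∶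
        π₃∶ = trans (Sg³-π₃∶ iso∶) (IsoLaws-inst π₂∶ _)

        fun : Tm (Γ ▹ A)
        fun = app (fst t iso∶) fst∶

        fun∶ : fun ∶ B [ wk ]ᵀ
        fun∶ = app∶

        inv : Tm (Γ ▹ B)
        inv = app (Sg³-π₂ iso∶) π₂∶

        inv∶ : inv ∶ A [ wk ]ᵀ
        inv∶ = app∶

        inv-fun : inv [ ext wk fun fun∶ ] ≡ vz
        inv-fun = LeftInv-sound (fst∶ {e = π₃∶})

        fun-inv : fun [ ext wk inv inv∶ ] ≡ vz
        fun-inv = LeftInv-sound (trans (snd∶ {e = π₃∶}) wk-instᵀ)

        lam-fun : lam fun ≡ fst t iso∶
        lam-fun = Π-η

        lam-inv : lam inv ≡ Sg³-π₂ iso∶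
        lam-inv = Π-η

    -- The usual computation `G′ = G ∘ F ∘ G′ = G`, with `G` a left and `G′` a right inverse of `F`.
    inv-unique : {F : Tm (Γ ▹ A)} {G G′ : Tm (Γ ▹ B)} {F∶ : F ∶ B [ wk ]ᵀ}
                 {G′∶ : G′ ∶ A [ wk ]ᵀ} →
                 G [ ext wk F F∶ ] ≡ vz → F [ ext wk G′ G′∶ ] ≡ vz → G ≡ G′
    inv-unique {F} {G} {G′} {F∶} {G′∶} p q =
      sym (trans (sym vz-ext) (trans ([]-cong (sym p)) (trans (sym [∘])
        (trans ([]-congˢ (Sub-ext
          (trans wk-ext-∘ (trans wk-ext (sym idʳ)))
          (trans vz-ext-∘ (trans q (sym [id])))))
        [id]))))

    laws-irr : ∀ {f f′ g g′ s s′} {f∶ : f ∶ A ⇒ B} {g∶ : g ∶ B ⇒ A}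
               {f′∶ : f′ ∶ A ⇒ B} {g′∶ : g′ ∶ B ⇒ A} → f ≡ f′ → g ≡ g′ →
               s ∶ LeftInv f f∶ g g∶ ×ᵀ LeftInv g g∶ f f∶ →
               s′ ∶ LeftInv f′ f′∶ g′ g′∶ ×ᵀ LeftInv g′ g′∶ f′ f′∶ → s ≡ s′
    laws-irr {f∶ = f∶} {g∶} {f′∶} {g′∶} refl refl s∶ s′∶
      with refl ← uip f∶ f′∶ | refl ← uip g∶ g′∶ = Sg-ext {e = s∶} {s′∶}
        (LeftInv-irr fst∶ fst∶)
        (LeftInv-irr (trans snd∶ wk-instᵀ) (trans snd∶ wk-instᵀ))

    opaque
      unfolding fun inv

      -- The forward map determines the backward map by `inv-unique`, and then the laws agree by
      -- `laws-irr`.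
      Iso-ext : ∀ {t t′} {t∶ : t ∶ Iso A B} {t′∶ : t′ ∶ Iso A B} →
                fun t∶ ≡ fun t′∶ → t ≡ t′
      Iso-ext {t} {t′} {t∶} {t′∶} p = Sg³-ext p₁ p₂
        (laws-irr p₁ p₂ (π₃∶ t∶) (π₃∶ t′∶))
        where
        p₁ : fst t (iso∶ t∶) ≡ fst t′ (iso∶ t′∶)
        p₁ = trans (sym (lam-fun t∶)) (trans (cong lam p) (lam-fun t′∶))
        p₂ : Sg³-π₂ (iso∶ t∶) ≡ Sg³-π₂ (iso∶ t′∶)
        p₂ = trans (sym (lam-inv t∶)) (trans (cong lam
               (inv-unique (inv-fun t∶) (trans ([]-cong p) (fun-inv t′∶)))) (lam-inv t′∶))

    opaque
      unfolding fun

      mkIso : {F : Tm (Γ ▹ A)} {G : Tm (Γ ▹ B)}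
              (F∶ : F ∶ B [ wk ]ᵀ) (G∶ : G ∶ A [ wk ]ᵀ) →
              G [ ext wk F F∶ ] ≡ vz → F [ ext wk G G∶ ] ≡ vz →
              Σ[ t ∈ Tm Γ ] Σ[ t∶ ∈ t ∶ Iso A B ] fun t∶ ≡ F
      mkIso {F} {G} F∶ G∶ gf fg =
        let t , t∶ , p = Sg³-pair (lam F) (lam G) _ (lam∶ F∶) (trans g∶ (sym wk-instᵀ))
                         (trans (pair∶ {e = LeftInv-intro (β gf)}
                                       {h = trans (LeftInv-intro (β fg)) (sym wk-instᵀ)})
                                (sym (IsoLaws-inst g∶ _)))
        in t , trans t∶ (sym (Iso≡Sg³ A B)) ,
           trans (app-cong {e′ = lam∶ F∶} refl (trans (fst-cong refl refl) p)) (Π-β F∶)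
        where
        g∶ : lam G ∶ B ⇒ A
        g∶ = lam∶ G∶
        -- Removes the β-redexes that arise because the laws speak of the abstractions `lam F` and
        -- `lam G`.
        β : ∀ {C D : Ty Γ} {H K} {H∶ : H ∶ D [ wk ]ᵀ} {K∶ : K ∶ C [ wk ]ᵀ} →
            K [ ext wk H H∶ ] ≡ vz →
            app (lam K) (lam∶ K∶) [ ext wk (app (lam H) (lam∶ H∶)) app∶ ] ≡ vz {A = C}
        β {H∶ = H∶} {K∶} p = trans ([]-cong (Π-β K∶))
          (trans ([]-congˢ (ext-cong refl (Π-β H∶))) p)

  -- Stability of isomorphisms, and their application to elements.

  []ᵀ-lift-wk : ∀ {Γ Δ} {A B : Ty Δ} {A′ : Ty Γ} {σ : Sub Γ Δ}
                (p : A′ ≡ A [ σ ]ᵀ) →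
                B [ wk {A = A} ]ᵀ [ lift[_] {σ = σ} p ]ᵀ ≡ B [ σ ]ᵀ [ wk ]ᵀ
  []ᵀ-lift-wk refl = wk-[]ᵀ

  []-lift-wk : ∀ {Γ Δ} {A : Ty Δ} {b : Tm Δ} {A′ : Ty Γ} {σ : Sub Γ Δ}
               (p : A′ ≡ A [ σ ]ᵀ) →
               b [ wk {A = A} ] [ lift[_] {σ = σ} p ] ≡ b [ σ ] [ wk ]
  []-lift-wk p = []-∘≡ wk-ext

  opaque
    unfolding IsoLaws

    IsoLaws-lift : ∀ {Γ Δ} {A B : Ty Δ} {σ : Sub Γ Δ}
                   (p : A [ σ ]ᵀ ⇒ B [ σ ]ᵀ ≡ (A ⇒ B) [ σ ]ᵀ)
                   (q : (B [ σ ]ᵀ ⇒ A [ σ ]ᵀ) [ wk ]ᵀ ≡ (B ⇒ A) [ wk ]ᵀ [ lift[ p ] ]ᵀ) →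
                   IsoLaws (A [ σ ]ᵀ) (B [ σ ]ᵀ) ≡ IsoLaws A B [ lift[ q ] ]ᵀ
    IsoLaws-lift {σ = σ} p q = sym (trans ×ᵀ-[] (×ᵀ-cong
      (LeftInv-lift ty≡ ty≡ f≡ g≡) (LeftInv-lift ty≡ ty≡ g≡ f≡)))
      where
      ty≡ : ∀ {C} → C [ σ ]ᵀ [ wk ]ᵀ [ wk ]ᵀ ≡ C [ wk ]ᵀ [ wk ]ᵀ [ lift[ q ] ]ᵀ
      ty≡ = sym (trans ([]ᵀ-lift-wk q) ([]ᵀ-cong ([]ᵀ-lift-wk p)))
      f≡ : vz [ wk ] ≡ vz [ wk ] [ lift[ q ] ]
      f≡ = sym (trans ([]-lift-wk q) ([]-cong vz-ext))
      g≡ : vz ≡ vz [ lift[ q ] ]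
      g≡ = sym vz-ext

  Iso-cong : ∀ {Γ} {A A′ B B′ : Ty Γ} → A ≡ A′ → B ≡ B′ → Iso A B ≡ Iso A′ B′
  Iso-cong refl refl = refl

  module _ {Γ Δ} {A B : Ty Δ} {σ : Sub Γ Δ} where
    private
      p : A [ σ ]ᵀ ⇒ B [ σ ]ᵀ ≡ (A ⇒ B) [ σ ]ᵀ
      p = sym ⇒-[]
      q : (B [ σ ]ᵀ ⇒ A [ σ ]ᵀ) [ wk ]ᵀ ≡ (B ⇒ A) [ wk ]ᵀ [ lift[ p ] ]ᵀ
      q = trans ([]ᵀ-cong (sym ⇒-[])) (sym ([]ᵀ-lift-wk p))
      inner : Sg ((B [ σ ]ᵀ ⇒ A [ σ ]ᵀ) [ wk ]ᵀ) (IsoLaws (A [ σ ]ᵀ) (B [ σ ]ᵀ)) ≡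
              Sg ((B ⇒ A) [ wk ]ᵀ) (IsoLaws A B) [ lift[ p ] ]ᵀ
      inner = sym (trans (Sg-lift q) (cong (Sg _) (sym (IsoLaws-lift p q))))

    Iso-[] : Iso A B [ σ ]ᵀ ≡ Iso (A [ σ ]ᵀ) (B [ σ ]ᵀ)
    Iso-[] = trans ([]ᵀ-cong (Iso≡Sg³ A B)) (trans (Sg-lift p)
      (trans (cong (Sg _) (sym inner)) (sym (Iso≡Sg³ _ _))))

    opaque
      unfolding fun

      fun-↑ : ∀ {t t′} {t∶ : t ∶ Iso A B} {t′∶ : t′ ∶ Iso (A [ σ ]ᵀ) (B [ σ ]ᵀ)} →
              t′ ≡ t [ σ ] → fun t∶ [ σ ↑ ] ≡ fun t′∶
      fun-↑ r = app-lift refl (sym wk-[]ᵀ) (sym (fst-lift p inner r))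

  fun-lift : ∀ {Γ Δ} {A B : Ty Δ} {A′ B′ : Ty Γ} {σ : Sub Γ Δ} {t t′}
             {t∶ : t ∶ Iso A B} {t′∶ : t′ ∶ Iso A′ B′}
             (p : A′ ≡ A [ σ ]ᵀ) → B′ ≡ B [ σ ]ᵀ → t′ ≡ t [ σ ] →
             fun t∶ [ lift[ p ] ] ≡ fun t′∶
  fun-lift refl refl r = fun-↑ r

  fun-cong : ∀ {Γ} {A B : Ty Γ} {t t′} {t∶ : t ∶ Iso A B} {t′∶ : t′ ∶ Iso A B} →
             t ≡ t′ → fun t∶ ≡ fun t′∶
  fun-cong {t∶ = t∶} {t′∶} refl = cong fun (uip t∶ t′∶)

  module _ {Γ} {A B : Ty Γ} {t : Tm Γ} (t∶ : t ∶ Iso A B) where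
    to : (b : Tm Γ) → b ∶ A → Tm Γ
    to b b∶ = fun t∶ [ inst b b∶ ]

    from : (b : Tm Γ) → b ∶ B → Tm Γ
    from b b∶ = inv t∶ [ inst b b∶ ]

    to∶ : ∀ {b} (b∶ : b ∶ A) → to b b∶ ∶ B
    to∶ b∶ = trans (∶-[] (fun∶ t∶) _) wk-instᵀ

    from∶ : ∀ {b} (b∶ : b ∶ B) → from b b∶ ∶ A
    from∶ b∶ = trans (∶-[] (inv∶ t∶) _) wk-instᵀ

    from-to : ∀ {b} {b∶ : b ∶ A} {h : to b b∶ ∶ B} → from (to b b∶) h ≡ b
    from-to {b} {b∶} = trans ([]-congˢ comm) (trans [∘] (trans ([]-cong (inv-fun t∶)) vz-ext))
      where
      comm : inst (to b b∶) _ ≡ ext wk (fun t∶) (fun∶ t∶) ∘ inst b b∶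
      comm = Sub-ext (trans wk-ext (sym (trans wk-ext-∘ wk-ext)))
                     (trans vz-ext (sym vz-ext-∘))

    to-from : ∀ {b} {b∶ : b ∶ B} {h : from b b∶ ∶ A} → to (from b b∶) h ≡ b
    to-from {b} {b∶} = trans ([]-congˢ comm) (trans [∘] (trans ([]-cong (fun-inv t∶)) vz-ext))
      where
      comm : inst (from b b∶) _ ≡ ext wk (inv t∶) (inv∶ t∶) ∘ inst b b∶
      comm = Sub-ext (trans wk-ext (sym (trans wk-ext-∘ wk-ext)))
                     (trans vz-ext (sym vz-ext-∘))

  to-cong : ∀ {Γ} {A B B′ : Ty Γ} {t t′ b b′} {t∶ : t ∶ Iso A B} {t′∶ : t′ ∶ Iso A B′}
            {b∶ : b ∶ A} {b′∶ : b′ ∶ A} → B ≡ B′ → t ≡ t′ → b ≡ b′ →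
            to t∶ b b∶ ≡ to t′∶ b′ b′∶
  to-cong {t∶ = t∶} {t′∶} {b∶} {b′∶} refl refl refl =
    cong₂ (λ h k → to h _ k) (uip t∶ t′∶) (uip b∶ b′∶)

  module _ {Γ Δ} {A B : Ty Δ} {A′ B′ : Ty Γ} {σ : Sub Γ Δ} {t t′}
           {t∶ : t ∶ Iso A B} {t′∶ : t′ ∶ Iso A′ B′}
           (p : A′ ≡ A [ σ ]ᵀ) (q : B′ ≡ B [ σ ]ᵀ) (r : t′ ≡ t [ σ ]) where

    to-[] : ∀ {b b′} {b∶ : b ∶ A} {b′∶ : b′ ∶ A′} → b′ ≡ b [ σ ] →
            to t∶ b b∶ [ σ ] ≡ to t′∶ b′ b′∶
    to-[] s = trans ([]-∘≡ (∘-inst p s)) ([]-cong (fun-lift p q r))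

    -- By `from-to`, the substituted preimage is recovered from its image under `to`, and that image
    -- is `b′` by `to-[]` and `to-from`.
    from-[] : ∀ {b b′} {b∶ : b ∶ B} {b′∶ : b′ ∶ B′} → b′ ≡ b [ σ ] →
              from t∶ b b∶ [ σ ] ≡ from t′∶ b′ b′∶
    from-[] {b} {b′} {b∶} {b′∶} s =
      trans (sym (from-to t′∶ {b∶ = x∶} {to∶ t′∶ x∶}))
        ([]-congˢ (inst-cong (trans (sym (to-[] {b∶ = from∶ t∶ b∶} refl))
          (trans ([]-cong (to-from t∶)) (sym s)))))
      where
      x∶ : from t∶ b b∶ [ σ ] ∶ A′
      x∶ = trans (∶-[] (from∶ t∶ b∶) σ) (sym p)

-- Substitution of Ψ-data and evaluation on the boundary.

module Boundary {a : Level} {X Xu : ETT a} (𝐓 : Transpension X Xu) where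
  private
    module X where
      open ETT X public
      open ETT-Properties X public
  open ETT Xu
  open ETT-Properties Xu
  open Isomorphisms Xu
  open Transpension 𝐓
  open ΨData

  ↑∂ : ∀ {Γ Δ} (σ : Sub Γ Δ) → Sub (Γ ▹ u∈∂) (Δ ▹ u∈∂)
  ↑∂ = lift∂ 𝐓

  -- The types `R D` and `R D′` share a context only once the types `A` are identified, so they are
  -- compared along a lift of `id`. After that identification the lift is the identity, and `∈U-irr`
  -- handles the universe memberships.
  ΨData-≡ : ∀ {Γ} {D D′ : ΨData 𝐓 Γ} → A D ≡ A D′ → ℓA D ≡ ℓA D′ → ℓR D ≡ ℓR D′ →
            (q : ∂Π 𝐓 (A D) ≡ ∂Π 𝐓 (A D′) [ id ]ᵀ) →
            R D ≡ R D′ X.[ Lt.lockˢ lift[ q ] ]ᵀ → D ≡ D′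
  ΨData-≡ {D = D} {D′} refl refl refl q r = lemma _ _ _ _ _ _ R≡
    where
    R≡ : R D ≡ R D′
    R≡ = trans r (trans (X.[]ᵀ-congˢ (trans (cong Lt.lockˢ (lift-id q)) Lt.lock-id)) X.[id]ᵀ)

    lemma : ∀ {Γ A ℓA ℓR} (A∈U A∈U′ : A ∈U ℓA) (R R′ : X.Ty (Lt.lock (Γ ▹ ∂Π 𝐓 A)))
            (R∈U : R X.∈U ℓR) (R∈U′ : R′ X.∈U ℓR) → R ≡ R′ →
            _≡_ {A = ΨData 𝐓 Γ}
              (record { A = A ; ℓA = ℓA ; A∈U = A∈U ; R = R ; ℓR = ℓR ; R∈U = R∈U })
              (record { A = A ; ℓA = ℓA ; A∈U = A∈U′ ; R = R′ ; ℓR = ℓR ; R∈U = R∈U′ })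
    lemma A∈U A∈U′ R R′ R∈U R∈U′ refl
      with refl ← ∈U-irr A∈U A∈U′ | refl ← X.∈U-irr R∈U R∈U′ = refl

  ↑∂-∘ : ∀ {Γ Δ Θ} {σ : Sub Δ Θ} {τ : Sub Γ Δ} → ↑∂ σ ∘ ↑∂ τ ≡ ↑∂ (σ ∘ τ)
  ↑∂-∘ = lift-∘ _ _ _

  infixl 8 _[_]ᵈ

  -- Only an opaque copy of _[_]ᴰ, as type checking becomes very slow when the
  -- substituted data unfold.
  opaque
    _[_]ᵈ : ∀ {Γ Δ} → ΨData 𝐓 Δ → Sub Γ Δ → ΨData 𝐓 Γ
    _[_]ᵈ = _[_]ᴰ 𝐓

    ᵈ≡ᴰ : ∀ {Γ Δ} (D : ΨData 𝐓 Δ) (σ : Sub Γ Δ) → D [ σ ]ᵈ ≡ _[_]ᴰ 𝐓 D σ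
    ᵈ≡ᴰ D σ = refl

    A-ᵈ : ∀ {Γ Δ} (D : ΨData 𝐓 Δ) (σ : Sub Γ Δ) → A (D [ σ ]ᵈ) ≡ A D [ ↑∂ σ ]ᵀ
    A-ᵈ D σ = refl

    ᵈ-∘ : ∀ {Γ Δ Θ} (D : ΨData 𝐓 Θ) (σ : Sub Δ Θ) (τ : Sub Γ Δ) →
          D [ σ ∘ τ ]ᵈ ≡ D [ σ ]ᵈ [ τ ]ᵈ
    ᵈ-∘ {Γ} {Δ} {Θ} D σ τ = ΨData-≡ A≡ refl refl q (sym R≡)
      where
      A≡ : A (D [ σ ∘ τ ]ᵈ) ≡ A (D [ σ ]ᵈ [ τ ]ᵈ)
      A≡ = trans ([]ᵀ-congˢ (sym ↑∂-∘)) [∘]ᵀ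
      p : ∂Π 𝐓 (A (D [ σ ]ᵈ)) ≡ ∂Π 𝐓 (A D) [ σ ]ᵀ
      p = sym (∂Π-[] 𝐓)
      p′ : ∂Π 𝐓 (A (D [ σ ]ᵈ [ τ ]ᵈ)) ≡ ∂Π 𝐓 (A (D [ σ ]ᵈ)) [ τ ]ᵀ
      p′ = sym (∂Π-[] 𝐓)
      q : ∂Π 𝐓 (A (D [ σ ∘ τ ]ᵈ)) ≡ ∂Π 𝐓 (A (D [ σ ]ᵈ [ τ ]ᵈ)) [ id ]ᵀ
      q = trans (cong (∂Π 𝐓) A≡) (sym [id]ᵀ)
      r : ∂Π 𝐓 (A (D [ σ ∘ τ ]ᵈ)) ≡ ∂Π 𝐓 (A D) [ σ ∘ τ ]ᵀ
      r = sym (∂Π-[] 𝐓)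
      lifts : lift[ p ] ∘ (lift[ p′ ] ∘ lift[ q ]) ≡ lift[ r ]
      lifts = Sub-ext
        (trans wk-ext-∘ (trans assoc (trans (∘-congʳ (trans wk-ext-∘ (trans assoc
          (∘-congʳ (trans wk-ext idˡ)))))
          (trans (sym assoc) (sym wk-ext)))))
        (trans vz-ext-∘ (trans vz-ext-∘ (trans vz-ext (sym vz-ext))))
      R≡ : R (D [ σ ]ᵈ [ τ ]ᵈ) X.[ Lt.lockˢ lift[ q ] ]ᵀ ≡ R (D [ σ ∘ τ ]ᵈ)
      R≡ = trans (sym X.[∘]ᵀ) (trans (sym X.[∘]ᵀ) (X.[]ᵀ-congˢ
        (trans (X.∘-congʳ (sym Lt.lock-∘)) (trans (sym Lt.lock-∘) (cong Lt.lockˢ lifts)))))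

  opaque
    unfolding _[_]ᵈ

    Total : ∀ {Γ} → ΨData 𝐓 Γ → Ty Γ
    Total D = Sg (∂Π 𝐓 (A D)) Lt.⟨∣ R D ⟩

    Total-[] : ∀ {Γ Δ} (D : ΨData 𝐓 Δ) {σ : Sub Γ Δ} → Total (D [ σ ]ᵈ) ≡ Total D [ σ ]ᵀ
    Total-[] D = sym (trans (Sg-lift (sym (∂Π-[] 𝐓))) (cong (Sg _) Lt.⟨∣⟩-[]))

    val : ∀ {Γ} (D : ΨData 𝐓 Γ) (x : Tm Γ) → x ∶ Total D → Tm (Γ ▹ u∈∂)
    val D x x∶ = app (fst x x∶) fst∶

    val∶ : ∀ {Γ} (D : ΨData 𝐓 Γ) {x} (x∶ : x ∶ Total D) → val D x x∶ ∶ A D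
    val∶ D x∶ = app∶

    val-[] : ∀ {Γ Δ} (D : ΨData 𝐓 Δ) {σ : Sub Γ Δ} {x x′} (x∶ : x ∶ Total D)
             {x′∶ : x′ ∶ Total (D [ σ ]ᵈ)} → x′ ≡ x [ σ ] →
             val D x x∶ [ ↑∂ σ ] ≡ val (D [ σ ]ᵈ) x′ x′∶
    val-[] D x∶ p = app-lift (sym u∈∂-[]) refl
      (sym (fst-lift (sym (∂Π-[] 𝐓)) (sym Lt.⟨∣⟩-[]) p))

  u∈∂-[]∶ : ∀ {Γ Δ} {p : Tm Δ} → p ∶ u∈∂ → (σ : Sub Γ Δ) → p [ σ ] ∶ u∈∂
  u∈∂-[]∶ p∶ σ = trans (∶-[] p∶ σ) u∈∂-[]

  -- Contexts that contain a proof of `u ∈ ∂𝕌`.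

  module _ {Γ} {p : Tm Γ} (p∶ : p ∶ u∈∂) where

    -- Proofs of `u∈∂` are irrelevant, so the weakened `p` is the variable itself. Thus `Γ` and
    -- `Γ ▹ u∈∂` are isomorphic contexts.
    inst-∘-wk : inst p p∶ ∘ wk ≡ id
    inst-∘-wk = Sub-ext (trans wk-ext-∘ (trans idˡ (sym idʳ)))
      (trans vz-ext-∘ (trans (Prf-irr (u∈∂-[]∶ p∶ wk) (trans vz∶ u∈∂-[])) (sym [id])))

    inst-wkᵀ : ∀ {B : Ty (Γ ▹ u∈∂)} → B [ inst p p∶ ]ᵀ [ wk ]ᵀ ≡ B
    inst-wkᵀ = trans (sym [∘]ᵀ) (trans ([]ᵀ-congˢ inst-∘-wk) [id]ᵀ)

    inst-wk : ∀ {b : Tm (Γ ▹ u∈∂)} → b [ inst p p∶ ] [ wk ] ≡ b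
    inst-wk = trans (sym [∘]) (trans ([]-congˢ inst-∘-wk) [id])

    -- `pole` lives over a context extended by `u∈∂`; here it is instantiated at the given proof
    -- `p`.
    ⟨∣⟩-point : ∀ (B : X.Ty (Lt.lock Γ)) → Σ[ t ∈ Tm Γ ] t ∶ Lt.⟨∣ B ⟩
    ⟨∣⟩-point B = pole _ [ inst p p∶ ] ,
      trans (∶-[] (trans pole∶ (sym Lt.⟨∣⟩-[])) (inst p p∶)) wk-instᵀ

    -- After weakening by `u∈∂` both terms are `pole`, and instantiating at `p` undoes the
    -- weakening.
    ⟨∣⟩-irr : ∀ {B : X.Ty (Lt.lock Γ)} {t t′} → t ∶ Lt.⟨∣ B ⟩ → t′ ∶ Lt.⟨∣ B ⟩ → t ≡ t′
    ⟨∣⟩-irr t∶ t′∶ = trans (sym (wk-inst {e = p∶})) (trans ([]-cong (trans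
      (pole-η (trans (∶-[] t∶ wk) Lt.⟨∣⟩-[]))
      (sym (pole-η (trans (∶-[] t′∶ wk) Lt.⟨∣⟩-[]))))) (wk-inst {e = p∶}))

    module _ (D : ΨData 𝐓 Γ) where
      val-inst : (x : Tm Γ) → x ∶ Total D → Tm Γ
      val-inst x x∶ = val D x x∶ [ inst p p∶ ]

      opaque
        unfolding val

        -- As `u∈∂` has at most one element, the value at `p` determines the whole first component.
        -- The second components then have the same type, where `⟨∣⟩-irr` applies.
        val-inst-injective : ∀ {x x′} {x∶ : x ∶ Total D} {x′∶ : x′ ∶ Total D} →
                             val-inst x x∶ ≡ val-inst x′ x′∶ → x ≡ x′
        val-inst-injective {x} {x′} {x∶} {x′∶} h = Sg-ext {e = x∶} {x′∶} fst≡
          (⟨∣⟩-irr {t = snd x x∶} (trans snd∶ Lt.⟨∣⟩-[])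
                   (trans (snd∶ {e = x′∶})
                     (trans ([]ᵀ-congˢ (inst-cong (sym fst≡))) Lt.⟨∣⟩-[])))
          where
          fst≡ : fst x x∶ ≡ fst x′ x′∶
          fst≡ = trans (sym (Π-η {e = fst∶})) (trans (cong lam
            (trans (sym inst-wk) (trans ([]-cong h) inst-wk))) (Π-η {e = fst∶}))

        -- The preimage pairs the constant function with value `b` with the point of the
        -- transpension type.
        val-inst-surjective : ∀ {b} → b ∶ A D [ inst p p∶ ]ᵀ →
          Σ[ x ∈ Tm Γ ] Σ[ x∶ ∈ x ∶ Total D ] val-inst x x∶ ≡ b
        val-inst-surjective {b} b∶ = _ , pair∶ {b = lam (b [ wk ])} {e = lam∶ b∶′} {h = t∶} ,
          trans ([]-cong (trans (app-cong {e′ = lam∶ b∶′} refl (Sg-β₁ {h = t∶})) (Π-β b∶′)))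
                wk-inst
          where
          b∶′ : b [ wk ] ∶ A D
          b∶′ = trans (∶-[] b∶ wk) inst-wkᵀ
          B : X.Ty (Lt.lock Γ)
          B = R D X.[ Lt.lockˢ (inst (lam (b [ wk ])) (lam∶ b∶′)) ]ᵀ
          t∶ : proj₁ (⟨∣⟩-point B) ∶ Lt.⟨∣ R D ⟩ [ inst (lam (b [ wk ])) (lam∶ b∶′) ]ᵀ
          t∶ = trans (proj₂ (⟨∣⟩-point B)) (sym Lt.⟨∣⟩-[])

  module _ {Γ} {p p′ : Tm Γ} {p∶ : p ∶ u∈∂} {p′∶ : p′ ∶ u∈∂} where
    val-inst-cong : ∀ {D D′ : ΨData 𝐓 Γ} {x x′} {x∶ : x ∶ Total D} {x′∶ : x′ ∶ Total D′} →
                    D ≡ D′ → x ≡ x′ → val-inst p∶ D x x∶ ≡ val-inst p′∶ D′ x′ x′∶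
    val-inst-cong {x∶ = x∶} {x′∶} refl refl
      with refl ← Prf-irr p∶ p′∶ with refl ← uip p∶ p′∶ | refl ← uip x∶ x′∶ = refl

  val-inst-[] : ∀ {Γ Δ} {p : Tm Δ} {p∶ : p ∶ u∈∂} {p′ : Tm Γ} {p′∶ : p′ ∶ u∈∂}
                {D : ΨData 𝐓 Δ} {σ : Sub Γ Δ} {x x′} {x∶ : x ∶ Total D}
                {x′∶ : x′ ∶ Total (D [ σ ]ᵈ)} → x′ ≡ x [ σ ] →
                val-inst p∶ D x x∶ [ σ ] ≡ val-inst p′∶ (D [ σ ]ᵈ) x′ x′∶
  val-inst-[] {p∶ = p∶} {p′∶ = p′∶} {D} {σ} {x∶ = x∶} {x′∶} r = trans
    ([]-∘≡ (∘-inst {e′ = p′∶} (sym u∈∂-[]) (Prf-irr p′∶ (u∈∂-[]∶ p∶ σ))))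
    ([]-cong (val-[] D x∶ {x′∶ = x′∶} r))

  -- value D σ evaluates elements of Total D at the boundary point vz [ σ ].  The
  -- forward map of the isomorphism is the case σ = wk; an arbitrary stage σ is
  -- allowed so that evaluation commutes with substitution.
  module _ {Γ Θ} (D : ΨData 𝐓 Γ) (σ : Sub Θ (Γ ▹ u∈∂)) where
    private
      p∶ : vz [ σ ] ∶ u∈∂
      p∶ = trans (vz-[]∶ σ) u∈∂-[]

      Total≡ : Total D [ wk ]ᵀ [ σ ]ᵀ ≡ Total (D [ wk ∘ σ ]ᵈ)
      Total≡ = trans (sym [∘]ᵀ) (sym (Total-[] D))

      ↑∂-inst : ↑∂ (wk ∘ σ) ∘ inst (vz [ σ ]) p∶ ≡ σ
      ↑∂-inst = trans (lift-inst (sym u∈∂-[]) (vz-[]∶ σ)) (ext-η (vz-[]∶ σ))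

      A≡ : A (D [ wk ∘ σ ]ᵈ) [ inst (vz [ σ ]) p∶ ]ᵀ ≡ A D [ σ ]ᵀ
      A≡ = trans ([]ᵀ-cong (A-ᵈ D (wk ∘ σ))) (trans (sym [∘]ᵀ) ([]ᵀ-congˢ ↑∂-inst))

    opaque
      value : (x : Tm Θ) → x ∶ Total D [ wk ]ᵀ [ σ ]ᵀ → Tm Θ
      value x x∶ = val-inst p∶ (D [ wk ∘ σ ]ᵈ) x (trans x∶ Total≡)

      value∶ : ∀ {x} (x∶ : x ∶ Total D [ wk ]ᵀ [ σ ]ᵀ) → value x x∶ ∶ A D [ σ ]ᵀ
      value∶ x∶ = trans (∶-[] (val∶ (D [ wk ∘ σ ]ᵈ) (trans x∶ Total≡)) _) A≡

      value-injective : ∀ {x x′ x∶ x′∶} → value x x∶ ≡ value x′ x′∶ → x ≡ x′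
      value-injective = val-inst-injective p∶ (D [ wk ∘ σ ]ᵈ)

      value-surjective : ∀ {b} → b ∶ A D [ σ ]ᵀ →
        Σ[ x ∈ Tm Θ ] Σ[ x∶ ∈ x ∶ Total D [ wk ]ᵀ [ σ ]ᵀ ] value x x∶ ≡ b
      value-surjective b∶ =
        let x , x∶ , h = val-inst-surjective p∶ (D [ wk ∘ σ ]ᵈ) (trans b∶ (sym A≡))
        in x , trans x∶ (sym Total≡) ,
           trans (cong (val-inst p∶ (D [ wk ∘ σ ]ᵈ) x) (uip _ x∶)) h

  opaque
    unfolding value

    -- `D` and `σ` enter only through the data `D [ wk ∘ σ ]ᵈ` and the boundary point, and the
    -- latter is irrelevant. This allows comparison of data over different contexts.
    value-cong : ∀ {Γ Γ′ Θ} {D : ΨData 𝐓 Γ} {D′ : ΨData 𝐓 Γ′} {σ : Sub Θ (Γ ▹ u∈∂)}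
                 {σ′ : Sub Θ (Γ′ ▹ u∈∂)} {x x′} {x∶ x′∶} →
                 D [ wk ∘ σ ]ᵈ ≡ D′ [ wk ∘ σ′ ]ᵈ → x ≡ x′ →
                 value D σ x x∶ ≡ value D′ σ′ x′ x′∶
    value-cong = val-inst-cong

    value-[] : ∀ {Γ Θ Λ} {D : ΨData 𝐓 Γ} {σ : Sub Θ (Γ ▹ u∈∂)} {τ : Sub Λ Θ}
               {σ′} {x x′} {x∶ x′∶} → σ′ ≡ σ ∘ τ → x′ ≡ x [ τ ] →
               value D σ x x∶ [ τ ] ≡ value D σ′ x′ x′∶
    value-[] {D = D} {σ} {τ} {x = x} {x∶ = x∶} refl refl = trans
      (val-inst-[] {p′∶ = u∈∂-[]∶ (trans (vz-[]∶ σ) u∈∂-[]) τ} {x′∶ = xτ∶} refl)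
      (val-inst-cong D≡ refl)
      where
      D≡ : D [ wk ∘ σ ]ᵈ [ τ ]ᵈ ≡ D [ wk ∘ (σ ∘ τ) ]ᵈ
      D≡ = trans (sym (ᵈ-∘ D _ _)) (cong (D [_]ᵈ) assoc)
      xτ∶ : x [ τ ] ∶ Total (D [ wk ∘ σ ]ᵈ [ τ ]ᵈ)
      xτ∶ = trans (∶-[] x∶ τ) (trans ([]ᵀ-cong (trans (sym [∘]ᵀ) (sym (Total-[] D))))
        (sym (Total-[] (D [ wk ∘ σ ]ᵈ))))

    -- Evaluation at the generic boundary point weakens `val D x x∶` and instantiates it at `vz`,
    -- which cancels by `inst-vz`.
    value-wk : ∀ {Γ} (D : ΨData 𝐓 Γ) {x} (x∶ : x ∶ Total D) {h} →
               value D id (x [ wk ]) h ≡ val D x x∶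
    value-wk {Γ} D {x} x∶ {h} = trans
      (val-inst-cong {p′∶ = vz-∶} {x′∶ = x′∶} (cong (D [_]ᵈ) idʳ) refl)
      (trans ([]-cong (sym (val-[] D x∶ {x′∶ = x′∶} refl)))
      (trans (sym [∘]) (trans ([]-congˢ (inst-vz {e = vz-∶} (sym u∈∂-[]))) [id])))
      where
      vz-∶ : vz {Γ} {u∈∂} ∶ u∈∂
      vz-∶ = trans vz∶ u∈∂-[]
      x′∶ : x [ wk ] ∶ Total (D [ wk {A = u∈∂} ]ᵈ)
      x′∶ = trans h (trans [id]ᵀ (sym (Total-[] D)))

  -- The isomorphism on the boundary and its stability under substitution.

  module _ {Γ} (D : ΨData 𝐓 Γ) where
    boundaryFun : Tm (Γ ▹ u∈∂ ▹ Total D [ wk ]ᵀ)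
    boundaryFun = value D wk vz vz∶

    opaque
      private
        G : Tm (Γ ▹ u∈∂ ▹ A D)
        -- Surjectivity at the generic element of `A D` yields the inverse map as a term. It is a
        -- right inverse by construction, and a left inverse by `value-injective`.
        G = proj₁ (value-surjective D wk vz∶)

        G∶ : G ∶ Total D [ wk ]ᵀ [ wk ]ᵀ
        G∶ = proj₁ (proj₂ (value-surjective D wk vz∶))

        value-G : value D wk G G∶ ≡ vz
        value-G = proj₂ (proj₂ (value-surjective D wk vz∶))

        F∶ : boundaryFun ∶ A D [ wk ]ᵀ
        F∶ = value∶ D wk vz∶

        G-F : G [ ext wk boundaryFun F∶ ] ≡ vz
        G-F = value-injective D wk {x∶ = trans (∶-[] G∶ _) stage≡} {vz∶}
          (trans (sym (value-[] {x∶ = G∶} (sym wk-ext) refl)) (trans ([]-cong value-G) vz-ext))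
          where
          stage≡ : Total D [ wk ]ᵀ [ wk ]ᵀ [ ext wk boundaryFun F∶ ]ᵀ ≡
                   Total D [ wk ]ᵀ [ wk ]ᵀ
          stage≡ = trans (sym [∘]ᵀ) ([]ᵀ-congˢ wk-ext)

        F-G : boundaryFun [ ext wk G G∶ ] ≡ vz
        F-G = trans (value-[] {x∶ = vz∶} (sym wk-ext) (sym vz-ext)) value-G

        iso : Σ[ t ∈ Tm (Γ ▹ u∈∂) ] Σ[ t∶ ∈ t ∶ Iso (Total D [ wk ]ᵀ) (A D) ]
                fun t∶ ≡ boundaryFun
        iso = mkIso F∶ G∶ G-F F-G

      boundaryIso : Tm (Γ ▹ u∈∂)
      boundaryIso = proj₁ iso

      boundaryIso∶ : boundaryIso ∶ Iso (Total D [ wk ]ᵀ) (A D)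
      boundaryIso∶ = proj₁ (proj₂ iso)

      fun-boundaryIso : fun boundaryIso∶ ≡ boundaryFun
      fun-boundaryIso = proj₂ (proj₂ iso)

    to-boundaryIso : ∀ {x} (x∶ : x ∶ Total D) {t} (t∶ : t ∶ Iso (Total D [ wk ]ᵀ) (A D))
                     {h : x [ wk ] ∶ Total D [ wk ]ᵀ} → t ≡ boundaryIso →
                     to t∶ (x [ wk ]) h ≡ val D x x∶
    to-boundaryIso {x} x∶ t∶ {h} p =
      trans ([]-cong (trans (fun-cong p) fun-boundaryIso))
      (trans (value-[] {σ′ = id} {x∶ = vz∶} {trans h (sym [id]ᵀ)} (sym wk-ext) (sym vz-ext))
        (value-wk D x∶))

  -- By `Iso-ext` only forward maps are compared. Both evaluate the variable `vz`, at stages whose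
  -- data agree by `ᵈ-∘`, so `value-cong` applies.
  boundaryIso-[] : ∀ {Γ Δ} (D : ΨData 𝐓 Δ) {σ : Sub Γ Δ} →
                   boundaryIso (D [ σ ]ᵈ) ≡ boundaryIso D [ ↑∂ σ ]
  boundaryIso-[] D {σ} = Iso-ext
    {t∶ = boundaryIso∶ (D [ σ ]ᵈ)}
    {t′∶ = trans (∶-[] (boundaryIso∶ D) (↑∂ σ))
                 (trans Iso-[] (Iso-cong (sym p) (sym (A-ᵈ D σ))))}
    (trans (fun-boundaryIso (D [ σ ]ᵈ)) (sym (trans (sym (fun-lift p (A-ᵈ D σ) refl))
      (trans ([]-cong (fun-boundaryIso D))
      (trans (value-[] {σ′ = ↑∂ σ ∘ wk} {x∶ = vz∶} {x∶} (sym wk-ext) (sym vz-ext))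
        (value-cong (trans (cong (D [_]ᵈ) (trans (sym assoc) (cong (_∘ wk) wk-ext)))
          (trans (cong (D [_]ᵈ) assoc) (ᵈ-∘ D _ _))) refl))))))
    where
    p : Total (D [ σ ]ᵈ) [ wk ]ᵀ ≡ Total D [ wk ]ᵀ [ ↑∂ σ ]ᵀ
    p = trans ([]ᵀ-cong (Total-[] D)) (sym ([]ᵀ-lift-wk (sym u∈∂-[])))
    x∶ : vz ∶ Total D [ wk ]ᵀ [ ↑∂ σ ∘ wk ]ᵀ
    x∶ = trans vz∶ (trans ([]ᵀ-cong p) (sym [∘]ᵀ))

-- The strictified type and its isomorphism with `Total`.

module Strictification {a : Level} {X Xu : ETT a} (𝐓 : Transpension X Xu)
                       (𝕊 : Strictness Xu) where
  private
    module X where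
      open ETT X public
      open ETT-Properties X public
    module 𝕊 = Strictness 𝕊
  open ETT Xu
  open ETT-Properties Xu
  open Isomorphisms Xu
  open Transpension 𝐓
  open ΨData
  open Boundary 𝐓

  ∈U-code-cong : ∀ {Γ ℓ} {B B′ : Ty Γ} (p : B ∈U ℓ) (q : B′ ∈U ℓ) → B ≡ B′ →
                 proj₁ p ≡ proj₁ q
  ∈U-code-cong p q refl = cong proj₁ (∈U-irr p q)

  module _ {Γ} (D : ΨData 𝐓 Γ) where
    -- The strictness axiom wants `Total D` and `A D` in one universe, hence the maximum of the two
    -- levels.
    A∈U-max : A D ∈U (ℓA D ⊔ ℓR D)
    A∈U-max = cumul (m≤m⊔n _ _) (A∈U D)

    opaque
      unfolding Total

      Total-∈U : Total D ∈U (ℓA D ⊔ ℓR D)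
      Total-∈U = Sg-∈U (Π-∈U (cumul z≤n Prf-∈U) A∈U-max)
                       (cumul (m≤n⊔m (ℓA D) (ℓR D)) (Lt.⟨∣⟩-∈U (R∈U D)))

    strictData : StrictData Xu Γ (ℓA D ⊔ ℓR D)
    strictData = record
      { φ  = ∂
      ; φ∶ = ∂∶
      ; A  = proj₁ Total-∈U
      ; A∶ = proj₁ (proj₂ Total-∈U)
      ; T  = proj₁ A∈U-max
      ; T∶ = proj₁ (proj₂ A∈U-max)
      ; i  = boundaryIso D
      ; i∶ = trans (boundaryIso∶ D)
          (sym (Iso-cong ([]ᵀ-cong (proj₂ (proj₂ Total-∈U))) (proj₂ (proj₂ A∈U-max))))
      }

  opaque
    unfolding _[_]ᵈ

    -- The strictness data are themselves stable: codes are determined by the types they decode to,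
    -- and the isomorphism is covered by `boundaryIso-[]`.
    strict-[] : ∀ {Γ Δ} (D : ΨData 𝐓 Δ) (σ : Sub Γ Δ) →
                𝕊.S (strictData D) [ σ ] ≡ 𝕊.S (strictData (D [ σ ]ᵈ)) ×
                𝕊.s (strictData D) [ σ ] ≡ 𝕊.s (strictData (D [ σ ]ᵈ))
    strict-[] D σ = 𝕊.S-[] D≡ , 𝕊.s-[] D≡
      where
      D≡ : _≡_[_]ˢ Xu {ℓ = ℓA D ⊔ ℓR D} (strictData (_[_]ᴰ 𝐓 D σ)) (strictData D) σ
      D≡ = record
        { φ≡   = sym ∂-[]
        ; A≡   = ∈U-code-cong (Total-∈U (D [ σ ]ᵈ)) (∈U-[] (Total-∈U D) σ) (Total-[] D)
        ; Prf≡ = sym u∈∂-[]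
        ; T≡   = ∈U-code-cong (A∈U-max (D [ σ ]ᵈ)) (∈U-[] (A∈U-max D) (↑∂ σ)) refl
        ; i≡   = boundaryIso-[] D
        }

  opaque
    Ψ : ∀ {Γ} → ΨData 𝐓 Γ → Ty Γ
    Ψ D = El (𝕊.S (strictData D)) 𝕊.S∶

    Ψ-∈U : ∀ {Γ} (D : ΨData 𝐓 Γ) → Ψ D ∈U (ℓA D ⊔ ℓR D)
    Ψ-∈U D = 𝕊.S (strictData D) , 𝕊.S∶ , refl

    Ψ-on : ∀ {Γ} (D : ΨData 𝐓 Γ) → Ψ D [ wk ]ᵀ ≡ A D
    Ψ-on D = trans El-[] (trans (El-cong 𝕊.S-on) (proj₂ (proj₂ (A∈U-max D))))

    glue : ∀ {Γ} (D : ΨData 𝐓 Γ) → Tm Γ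
    glue D = 𝕊.s (strictData D)

    glue∶ : ∀ {Γ} (D : ΨData 𝐓 Γ) → glue D ∶ Iso (Total D) (Ψ D)
    glue∶ D = trans 𝕊.s∶ (Iso-cong (proj₂ (proj₂ (Total-∈U D))) refl)

    glue-on : ∀ {Γ} (D : ΨData 𝐓 Γ) → glue D [ wk ] ≡ boundaryIso D
    glue-on D = 𝕊.s-on

  opaque
    unfolding Ψ _[_]ᵈ

    Ψ-[] : ∀ {Γ Δ} (D : ΨData 𝐓 Δ) (σ : Sub Γ Δ) → Ψ D [ σ ]ᵀ ≡ Ψ (D [ σ ]ᵈ)
    Ψ-[] D σ = trans El-[] (El-cong (proj₁ (strict-[] D σ)))

    glue-[] : ∀ {Γ Δ} (D : ΨData 𝐓 Δ) (σ : Sub Γ Δ) → glue D [ σ ] ≡ glue (D [ σ ]ᵈ)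
    glue-[] D σ = proj₂ (strict-[] D σ)

  -- Elements of `Total`, their components, and naturality of `unmerid`.

  private
    R⟨_,_,_⟩ : ∀ {Γ} (D : ΨData 𝐓 Γ) (b : Tm (Γ ▹ u∈∂)) → b ∶ A D → X.Ty (Lt.lock Γ)
    R⟨ D , b , b∶ ⟩ = R[_,_] D (lam b) (lam∶ b∶)

  R-cong : ∀ {Γ} {D D′ : ΨData 𝐓 Γ} {b b′ b∶ b′∶} → D ≡ D′ → b ≡ b′ →
           R⟨ D , b , b∶ ⟩ ≡ R⟨ D′ , b′ , b′∶ ⟩
  R-cong {D = D} {b = b} {b∶ = b∶} {b′∶} refl refl = cong R⟨ D , b ,_⟩ (uip b∶ b′∶)

  opaque
    unfolding _[_]ᵈ

    R-[] : ∀ {Γ Δ} (D : ΨData 𝐓 Δ) (σ : Sub Γ Δ) {b b∶ b′∶} →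
           R⟨ D , b , b∶ ⟩ X.[ Lt.lockˢ σ ]ᵀ ≡ R⟨ D [ σ ]ᵈ , b [ ↑∂ σ ] , b′∶ ⟩
    R-[] D σ = X.[]ᵀ-∘≡ (trans (sym Lt.lock-∘) (trans (cong Lt.lockˢ
      (∘-inst (sym (∂Π-[] 𝐓)) (sym (lam-lift (sym u∈∂-[]))))) Lt.lock-∘))

  module _ {Γ} (D : ΨData 𝐓 Γ) {b r} (b∶ : b ∶ A D) (r∶ : r X.∶ R⟨ D , b , b∶ ⟩) where
    opaque
      unfolding Total

      mkTotal : Tm Γ
      mkTotal = pair (lam b) (lam∶ b∶) (Lt.mod r) (trans (Lt.mod∶ r∶) (sym Lt.⟨∣⟩-[]))

      mkTotal∶ : mkTotal ∶ Total D
      mkTotal∶ = pair∶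

      val-mkTotal : ∀ {h} → val D mkTotal h ≡ b
      val-mkTotal = trans
        (app-cong {e′ = lam∶ b∶} refl (trans (fst-cong refl refl) Sg-β₁)) (Π-β b∶)

  module _ {Γ} (D : ΨData 𝐓 Γ) {x} (x∶ : x ∶ Total D) where
    opaque
      unfolding Total

      sndTotal : Tm Γ
      sndTotal = snd x x∶

      sndTotal∶ : sndTotal ∶ Lt.⟨∣ R⟨ D , val D x x∶ , val∶ D x∶ ⟩ ⟩
      sndTotal∶ = trans (snd∶ {e = x∶}) (trans ([]ᵀ-congˢ (inst-cong (sym Π-η))) Lt.⟨∣⟩-[])

  opaque
    unfolding mkTotal sndTotal _[_]ᵈ

    mkTotal-cong : ∀ {Γ} {D D′ : ΨData 𝐓 Γ} {b b′ r r′ b∶ b′∶ r∶ r′∶} →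
                   D ≡ D′ → b ≡ b′ → r ≡ r′ →
                   mkTotal D {b} {r} b∶ r∶ ≡ mkTotal D′ {b′} {r′} b′∶ r′∶
    mkTotal-cong refl p q = pair-cong refl (cong lam p) (cong Lt.mod q)

    mkTotal-[] : ∀ {Γ Δ} {D : ΨData 𝐓 Δ} {σ : Sub Γ Δ} {b r b∶ r∶ b∶′ r∶′} →
                 mkTotal D {b} {r} b∶ r∶ [ σ ] ≡
                 mkTotal (D [ σ ]ᵈ) {b [ ↑∂ σ ]} {r X.[ Lt.lockˢ σ ]} b∶′ r∶′
    mkTotal-[] = pair-lift (sym (∂Π-[] 𝐓)) (sym Lt.⟨∣⟩-[])
      (sym (lam-lift (sym u∈∂-[]))) (sym Lt.mod-[])

    sndTotal-mkTotal : ∀ {Γ} {D : ΨData 𝐓 Γ} {b r b∶ r∶ x} {x∶ : x ∶ Total D} →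
                       x ≡ mkTotal D {b} {r} b∶ r∶ → sndTotal D x∶ ≡ Lt.mod r
    sndTotal-mkTotal p = trans (snd-cong refl p) Sg-β₂

    mkTotal-η : ∀ {Γ} {D : ΨData 𝐓 Γ} {b r b∶ r∶ x} {x∶ : x ∶ Total D} →
                b ≡ val D x x∶ → Lt.mod r ≡ sndTotal D x∶ →
                mkTotal D {b} {r} b∶ r∶ ≡ x
    mkTotal-η p q = trans (pair-cong refl (trans (cong lam p) Π-η) q) Sg-η

    sndTotal-[] : ∀ {Γ Δ} {D : ΨData 𝐓 Δ} {σ : Sub Γ Δ} {x x′} {x∶ : x ∶ Total D}
                  {x′∶ : x′ ∶ Total (D [ σ ]ᵈ)} → x′ ≡ x [ σ ] →
                  sndTotal D x∶ [ σ ] ≡ sndTotal (D [ σ ]ᵈ) x′∶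
    sndTotal-[] = snd-lift (sym (∂Π-[] 𝐓)) (sym Lt.⟨∣⟩-[])

  sndTotal-cong : ∀ {Γ} {D D′ : ΨData 𝐓 Γ} {x x′} {x∶ : x ∶ Total D}
                  {x′∶ : x′ ∶ Total D′} →
                  D ≡ D′ → x ≡ x′ → sndTotal D x∶ ≡ sndTotal D′ x′∶
  sndTotal-cong {x∶ = x∶} {x′∶} refl refl = cong (sndTotal _) (uip x∶ x′∶)

  unmerid-cong : ∀ {Δ} {B B′ : X.Ty (Lt.lock (L∀.lock Δ))} {t t′ : Tm (L∀.lock Δ)}
                 {t∶ : t ∶ Lt.⟨∣ B ⟩} {t′∶ : t′ ∶ Lt.⟨∣ B′ ⟩} → B ≡ B′ → t ≡ t′ →
                 unmerid t t∶ ≡ unmerid t′ t′∶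
  unmerid-cong {t∶ = t∶} {t′∶} refl refl = cong (unmerid _) (uip t∶ t′∶)

  -- Every `t` is of the form `mod b` by `𝐭-η`, and on such terms `𝐭-β` reduces the claim to
  -- naturality of `const`.
  unmerid-[] : ∀ {Δ Δ′} {B : X.Ty (Lt.lock (L∀.lock Δ))} {t : Tm (L∀.lock Δ)}
               {t∶ : t ∶ Lt.⟨∣ B ⟩} {σ : X.Sub Δ′ Δ} {t′∶} →
               unmerid t t∶ X.[ σ ] ≡
               unmerid {A = B X.[ Lt.lockˢ (L∀.lockˢ σ) ]ᵀ} (t [ L∀.lockˢ σ ]) t′∶
  unmerid-[] {B = B} {t} {t∶} {σ} {t′∶} = begin
    unmerid t t∶ X.[ σ ]
      ≡⟨ X.[]-cong (trans (unmerid-cong refl (𝐭-η t∶)) (𝐭-β b∶)) ⟩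
    b X.[ const ] X.[ σ ]
      ≡⟨ X.[]-∘≡ (sym (const-nat σ)) ⟩
    b X.[ Lt.lockˢ (L∀.lockˢ σ) ] X.[ const ]
      ≡⟨ 𝐭-β (X.∶-[] b∶ _) ⟨
    unmerid (Lt.mod (b X.[ Lt.lockˢ (L∀.lockˢ σ) ])) _
      ≡⟨ unmerid-cong refl (trans (sym Lt.mod-[]) ([]-cong (sym (𝐭-η t∶)))) ⟩
    unmerid (t [ L∀.lockˢ σ ]) t′∶ ∎
    where
    open ≡-Reasoning
    t-app∶ : t [ appˢ ] ∶ Lt.⟨∣ B X.[ Lt.lockˢ appˢ ]ᵀ ⟩
    t-app∶ = trans (∶-[] t∶ appˢ) Lt.⟨∣⟩-[]
    b : X.Tm (Lt.lock (L∀.lock _))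
    b = unmerid (t [ appˢ ]) t-app∶
    b∶ : b X.∶ B
    -- A priori the type is `B` pulled back along `appˢ` under the lock and then `const`; the
    -- triangle identity cancels the two.
    b∶ = trans unmerid∶ (trans (sym X.[∘]ᵀ) (trans (X.[]ᵀ-congˢ triangle𝐭) X.[id]ᵀ))

  -- The rules of the Ψ-type.

  on∂-∶ : ∀ {Γ} (D : ΨData 𝐓 Γ) {q} → q ∶ Ψ D → q [ wk ] ∶ A D
  on∂-∶ D q∶ = trans (∶-[] q∶ wk) (Ψ-on D)

  module _ {Γ} (D : ΨData 𝐓 Γ) where
    opaque
      -- On the boundary `glue` is `boundaryIso`, whose forward map is evaluation. This is why `inΨ`
      -- restricts strictly to `b`.
      to-glue-on : ∀ {x} (x∶ : x ∶ Total D) → to (glue∶ D) x x∶ [ wk ] ≡ val D x x∶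
      to-glue-on x∶ = trans
        (to-[] {t′∶ = boundaryIso∶ D} refl (sym (Ψ-on D)) (sym (glue-on D))
               {b′∶ = ∶-[] x∶ wk} refl)
        (to-boundaryIso D x∶ (boundaryIso∶ D) refl)

      inΨ : ∀ {b r} (b∶ : b ∶ A D) (r∶ : r X.∶ R⟨ D , b , b∶ ⟩) → Tm Γ
      inΨ b∶ r∶ = to (glue∶ D) (mkTotal D b∶ r∶) (mkTotal∶ D b∶ r∶)

      inΨ∶ : ∀ {b r} (b∶ : b ∶ A D) (r∶ : r X.∶ R⟨ D , b , b∶ ⟩) → inΨ b∶ r∶ ∶ Ψ D
      inΨ∶ b∶ r∶ = to∶ (glue∶ D) (mkTotal∶ D b∶ r∶)

      inΨ-on : ∀ {b r} (b∶ : b ∶ A D) (r∶ : r X.∶ R⟨ D , b , b∶ ⟩) → inΨ b∶ r∶ [ wk ] ≡ b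
      inΨ-on b∶ r∶ = trans (to-glue-on _) (val-mkTotal D b∶ r∶)

    module _ {q} (q∶ : q ∶ Ψ D) where
      opaque
        fromΨ : Tm Γ
        fromΨ = from (glue∶ D) q q∶

        fromΨ∶ : fromΨ ∶ Total D
        fromΨ∶ = from∶ (glue∶ D) q∶

        -- `to-glue-on` at the preimage of `q`. It lets the type of `sndΨ` mention `q` itself
        -- instead of its preimage.
        val-fromΨ : val D fromΨ fromΨ∶ ≡ q [ wk ]
        val-fromΨ = trans (sym (to-glue-on fromΨ∶)) ([]-cong (to-from (glue∶ D)))

        sndΨ : Tm Γ
        sndΨ = sndTotal D fromΨ∶

        sndΨ∶ : sndΨ ∶ Lt.⟨∣ R⟨ D , q [ wk ] , on∂-∶ D q∶ ⟩ ⟩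
        sndΨ∶ = trans (sndTotal∶ D fromΨ∶) (cong Lt.⟨∣_⟩ (R-cong {D = D} refl val-fromΨ))

    opaque
      unfolding inΨ fromΨ

      sndΨ-inΨ : ∀ {b r} (b∶ : b ∶ A D) (r∶ : r X.∶ R⟨ D , b , b∶ ⟩) →
                 sndΨ (inΨ∶ b∶ r∶) ≡ Lt.mod r
      sndΨ-inΨ b∶ r∶ = sndTotal-mkTotal (from-to (glue∶ D))

      -- `q` is the image of `fromΨ q∶`, whose components are the boundary value of `q`, by
      -- `val-fromΨ`, and `mod r`, by hypothesis.
      inΨ-η : ∀ {q} (q∶ : q ∶ Ψ D) {r r∶} → sndΨ q∶ ≡ Lt.mod r →
              q ≡ inΨ {r = r} (on∂-∶ D q∶) r∶
      inΨ-η q∶ p = trans (sym (to-from (glue∶ D) {h = fromΨ∶ q∶}))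
        (to-cong refl refl (sym (mkTotal-η (sym (val-fromΨ q∶)) (sym p))))

  -- The substituted data D′ are a variable, so that the following lemmas apply to
  -- D [ σ ]ᴰ without unfolding it.
  module _ {Γ Δ} {D : ΨData 𝐓 Δ} {D′ : ΨData 𝐓 Γ} {σ : Sub Γ Δ} (D≡ : D′ ≡ D [ σ ]ᵈ) where
    Ψ-[]′ : Ψ D [ σ ]ᵀ ≡ Ψ D′
    Ψ-[]′ = trans (Ψ-[] D σ) (cong Ψ (sym D≡))

    private
      glue≡ : glue D′ ≡ glue D [ σ ]
      glue≡ = trans (cong glue D≡) (sym (glue-[] D σ))
      Total≡ : Total D′ ≡ Total D [ σ ]ᵀ
      Total≡ = trans (cong Total D≡) (Total-[] D)

    R-[]′ : ∀ {b b′ b∶ b′∶} → b′ ≡ b [ ↑∂ σ ] →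
            R⟨ D , b , b∶ ⟩ X.[ Lt.lockˢ σ ]ᵀ ≡ R⟨ D′ , b′ , b′∶ ⟩
    R-[]′ {b′∶ = b′∶} refl = trans
      (R-[] D σ {b′∶ = trans b′∶ (cong A D≡)}) (R-cong (sym D≡) refl)

    R-wk-[] : ∀ {q} {q∶ : q ∶ Ψ D} {q′∶ : q [ σ ] ∶ Ψ D′} →
              R⟨ D , q [ wk ] , on∂-∶ D q∶ ⟩ X.[ Lt.lockˢ σ ]ᵀ ≡
              R⟨ D′ , q [ σ ] [ wk ] , on∂-∶ D′ q′∶ ⟩
    R-wk-[] = R-[]′ (sym ([]-lift-wk (sym u∈∂-[])))

    opaque
      unfolding inΨ fromΨ

      inΨ-[] : ∀ {b r b∶ r∶ b∶′ r∶′} →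
               inΨ D {b} {r} b∶ r∶ [ σ ] ≡ inΨ D′ {b [ ↑∂ σ ]} {r X.[ Lt.lockˢ σ ]} b∶′ r∶′
      inΨ-[] {b∶′ = b∶′} {r∶′} = to-[] Total≡ (sym Ψ-[]′) glue≡ (sym (trans
        (mkTotal-[] {b∶′ = trans b∶′ (cong A D≡)} {r∶′ = trans r∶′ (R-cong D≡ refl)})
        (mkTotal-cong (sym D≡) refl refl)))

      -- `from-[]` moves the substitution past the inverse of `glue`, and `sndTotal-[]` past the
      -- projection.
      sndΨ-[] : ∀ {q} {q∶ : q ∶ Ψ D} {q′∶ : q [ σ ] ∶ Ψ D′} →
                sndΨ D q∶ [ σ ] ≡ sndΨ D′ q′∶
      sndΨ-[] {q∶ = q∶} {q′∶} = trans
        (sndTotal-[] {x′∶ = trans (fromΨ∶ D′ q′∶) (cong Total D≡)}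
          (sym (from-[] Total≡ (sym Ψ-[]′) glue≡ refl)))
        (sndTotal-cong (sym D≡) refl)

  opaque
    outΨ : ∀ {Δ} (D : ΨData 𝐓 (L∀.lock Δ)) {q} → q ∶ Ψ D → X.Tm Δ
    outΨ D q∶ = unmerid (sndΨ D q∶) (sndΨ∶ D q∶)

    outΨ∶ : ∀ {Δ} (D : ΨData 𝐓 (L∀.lock Δ)) {q} (q∶ : q ∶ Ψ D) →
            outΨ D q∶ X.∶ R⟨ D , q [ wk ] , on∂-∶ D q∶ ⟩ X.[ const ]ᵀ
    outΨ∶ D q∶ = unmerid∶

    outΨ-[] : ∀ {Δ Δ′} {D : ΨData 𝐓 (L∀.lock Δ)} {D′ : ΨData 𝐓 (L∀.lock Δ′)}
              {σ : X.Sub Δ′ Δ} → D′ ≡ D [ L∀.lockˢ σ ]ᵈ → ∀ {q} {q∶ : q ∶ Ψ D}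
              {q′∶ : q [ L∀.lockˢ σ ] ∶ Ψ D′} → outΨ D q∶ X.[ σ ] ≡ outΨ D′ q′∶
    outΨ-[] {D = D} {D′} {σ} D≡ {q∶ = q∶} {q′∶} = trans
      (unmerid-[] {t′∶ = trans (∶-[] (sndΨ∶ D q∶) (L∀.lockˢ σ)) Lt.⟨∣⟩-[]})
      (unmerid-cong (R-wk-[] {D = D} {D′} D≡ {q∶ = q∶} {q′∶}) (sndΨ-[] D≡))

    -- `sndΨ` of the introduced element is `mod r`, so the claim becomes the β-law of the
    -- transpension type.
    Ψ-β : ∀ {Δ} (D : ΨData 𝐓 (L∀.lock Δ)) {b r} (b∶ : b ∶ A D)
          (r∶ : r X.∶ R⟨ D , b , b∶ ⟩) → outΨ D (inΨ∶ D b∶ r∶) ≡ r X.[ const ]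
    Ψ-β D b∶ r∶ = trans
      (unmerid-cong (R-cong {D = D} refl (inΨ-on D b∶ r∶)) (sndΨ-inΨ D b∶ r∶)) (𝐭-β r∶)

    -- `𝐭-η` expands `sndΨ D q∶` as `mod` of an `unmerid` at `q [ appˢ ]`, and stability of `sndΨ`
    -- identifies that `unmerid` with `outΨ`.
    Ψ-η : ∀ {Γ} {D : ΨData 𝐓 Γ} {D′ : ΨData 𝐓 (L∀.lock (Lt.lock Γ))} → D′ ≡ D [ appˢ ]ᵈ →
          ∀ {q} {q∶ : q ∶ Ψ D} {q′∶ : q [ appˢ ] ∶ Ψ D′} →
          Σ[ r∶ ∈ outΨ D′ q′∶ X.∶ R⟨ D , q [ wk ] , on∂-∶ D q∶ ⟩ ]
          q ≡ inΨ D (on∂-∶ D q∶) r∶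
    Ψ-η {D = D} {D′} D≡ {q} {q∶} {q′∶} =
      r∶ , inΨ-η D q∶ (trans (𝐭-η (sndΨ∶ D q∶)) (cong Lt.mod r≡))
      where
      t∶ : sndΨ D q∶ [ appˢ ] ∶ Lt.⟨∣ R⟨ D , q [ wk ] , on∂-∶ D q∶ ⟩ X.[ Lt.lockˢ appˢ ]ᵀ ⟩
      t∶ = trans (∶-[] (sndΨ∶ D q∶) appˢ) Lt.⟨∣⟩-[]
      r≡ : unmerid (sndΨ D q∶ [ appˢ ]) t∶ ≡ outΨ D′ q′∶
      r≡ = unmerid-cong (R-wk-[] {D = D} {D′} D≡ {q∶ = q∶} {q′∶}) (sndΨ-[] D≡)
      r∶ : outΨ D′ q′∶ X.∶ R⟨ D , q [ wk ] , on∂-∶ D q∶ ⟩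
      -- The pullbacks along `appˢ` and `const` again cancel by the triangle identity, which gives
      -- the type that `inΨ` demands.
      r∶ = trans (cong X.ty (sym r≡)) (trans unmerid∶
        (trans (sym X.[∘]ᵀ) (trans (X.[]ᵀ-congˢ triangle𝐭) X.[id]ᵀ)))

  Ψ-type : ΨType 𝐓
  Ψ-type = record
    { Ψ       = Ψ
    ; Ψ-∈U    = Ψ-∈U
    ; Ψ-[]    = λ D σ → Ψ-[]′ (sym (ᵈ≡ᴰ D σ))
    ; Ψ-on    = Ψ-on
    ; inΨ     = λ D _ b∶ _ r∶ → inΨ D b∶ r∶
    ; inΨ∶    = λ D b∶ r∶ → inΨ∶ D b∶ r∶
    ; inΨ-[]  = λ D b∶ r∶ σ →
        trans (X.∶-[] r∶ (Lt.lockˢ σ)) (R-[]′ {D = D} (sym (ᵈ≡ᴰ D σ)) refl) ,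
        inΨ-[] (sym (ᵈ≡ᴰ D σ))
    ; inΨ-on  = λ D b∶ r∶ → inΨ-on D b∶ r∶
    ; outΨ    = λ D _ q∶ → outΨ D q∶
    ; outΨ∶   = outΨ∶
    ; outΨ-[] = λ D q∶ σ → outΨ-[] (sym (ᵈ≡ᴰ D (L∀.lockˢ σ)))
    ; Ψ-β     = λ D b∶ r∶ → Ψ-β D b∶ r∶
    ; Ψ-η     = λ D q∶ → Ψ-η (sym (ᵈ≡ᴰ D appˢ))
    }

theorem10p2 : {a : Level} (𝕋 : TypeSystem a) (X : TypeSystem.Mode 𝕋) (𝕌 : TypeSystem.Shape 𝕋) →
    ΨType (TypeSystem.transpension 𝕋 X 𝕌)
-- Ψ is a type at mode `𝕌 ∷ X`, so the strictness axiom is used at that mode.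
theorem10p2 𝕋 X 𝕌 = Strictification.Ψ-type (TypeSystem.transpension 𝕋 X 𝕌)
                                           (TypeSystem.strictness 𝕋 (𝕌 ∷ X))
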